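{- Let $q$ be a prime power, let $m\ge 1$ and $n\geq 2$ be integers, let $h$ be an integer with $1\le h\le m$, and let $X$ be a vector space over $\mathbb{F}_q$ of dimension $mn$. There exists an $m$-spread $\mathcal{A}$ in $X$ for which there exists an $(\mathcal{A},h)$-evasive $\mathbb{F}_q$-subspace of $X$ of dimension $m(n-1)+h-1$.
   Context: An $m$-spread of $X$ is a collection $\mathcal{A}$ of $m$-dimensional $\mathbb{F}_q$-subspaces of $X$, pairwise intersecting trivially, such that every non-zero vector of $X$ lies in exactly one element of $\mathcal{A}$. An $\mathbb{F}_q$-subspace $U\le X$ is $(\mathcal{A},h)$-evasive if $\dim_{\mathbb{F}_q}(U\cap S)\leq h$ for all $S\in\mathcal{A}$. -}

module Defs where

open import Level using (Level; _⊔_; suc)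
open import Algebra.Apartness.Bundles using (HeytingField; HeytingCommutativeRing)
open import Algebra.Bundles using (CommutativeRing)
open import Algebra.Module.Bundles using (Module)
import Algebra.Properties.CommutativeMonoid.Sum as Sum
open import Data.Fin.Base using (Fin)
open import Data.Nat.Base as ℕ using (ℕ)
open import Data.Nat.Primality using (Prime)
open import Data.Product using (∃; ∃₂; ∃!; _×_; _,_)
open import Data.Unit.Polymorphic.Base using (⊤)
open import Data.Vec.Functional using (Vector)
open import Function.Bundles using (Bijection)
open import Relation.Binary.Definitions using (_Respects_)
open import Relation.Binary.PropositionalEquality using (_≡_)
import Relation.Binary.PropositionalEquality as ≡
open import Relation.Nullary.Negation using (¬_)
open import Relation.Unary using (Pred; _∈_; _≐_)

PrimePower : ℕ → Set
PrimePower q = ∃₂ λ p k → Prime p × 1 ℕ.≤ k × q ≡ p ℕ.^ k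

-- A finite Heyting field has decidable equality and its apartness is just
-- inequality, so together with HasOrder F q this is the usual notion of a
-- field with q elements.
fieldRing : ∀ {c ℓ₁ ℓ₂} → HeytingField c ℓ₁ ℓ₂ → CommutativeRing c ℓ₁
fieldRing F =
  HeytingCommutativeRing.commutativeRing (HeytingField.heytingCommutativeRing F)

HasOrder : ∀ {c ℓ₁ ℓ₂} → HeytingField c ℓ₁ ℓ₂ → ℕ → Set (c ⊔ ℓ₁)
HasOrder F q = Bijection (≡.setoid (Fin q)) (CommutativeRing.setoid (fieldRing F))

VectorSpace : ∀ {c ℓ₁ ℓ₂} → HeytingField c ℓ₁ ℓ₂ → (a ℓ : Level) →
              Set (c ⊔ ℓ₁ ⊔ suc (a ⊔ ℓ))
VectorSpace F a ℓ = Module (fieldRing F) a ℓ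

-- The definitions below only mention the ring structure of the scalars, so they
-- are written for modules; they are meant for (and applied to) vector spaces.
module _ {c ℓ₁ a ℓ : Level} {R : CommutativeRing c ℓ₁} (X : Module R a ℓ) where

  open CommutativeRing R using (Carrier; _≈_; 0#)
  open Module X
  open Sum +ᴹ-commutativeMonoid using (sum)

  -- The predicates defining subspaces live at a level large enough to contain
  -- spans of families of vectors.
  record Subspace : Set (suc (c ⊔ ℓ₁ ⊔ a ⊔ ℓ)) where
    field
      member    : Pred Carrierᴹ (c ⊔ ℓ₁ ⊔ a ⊔ ℓ)
      resp-≈ᴹ   : member Respects _≈ᴹ_
      0ᴹ-closed : 0ᴹ ∈ member
      +ᴹ-closed : ∀ {x y} → x ∈ member → y ∈ member → (x +ᴹ y) ∈ member
      *ₗ-closed : ∀ r {x} → x ∈ member → (r *ₗ x) ∈ member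

  open Subspace using (member)

  _≋_ : Subspace → Subspace → Set (c ⊔ ℓ₁ ⊔ a ⊔ ℓ)
  S ≋ T = member S ≐ member T

  whole : Subspace
  whole = record
    { member    = λ _ → ⊤
    ; resp-≈ᴹ   = λ _ _ → _
    ; 0ᴹ-closed = _
    ; +ᴹ-closed = λ _ _ → _
    ; *ₗ-closed = λ _ _ → _
    }

  _∩_ : Subspace → Subspace → Subspace
  S ∩ T = record
    { member    = λ x → x ∈ member S × x ∈ member T
    ; resp-≈ᴹ   = λ x≈y (s , t) → S.resp-≈ᴹ x≈y s , T.resp-≈ᴹ x≈y t
    ; 0ᴹ-closed = S.0ᴹ-closed , T.0ᴹ-closed
    ; +ᴹ-closed = λ (s , t) (s′ , t′) → S.+ᴹ-closed s s′ , T.+ᴹ-closed t t′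
    ; *ₗ-closed = λ r (s , t) → S.*ₗ-closed r s , T.*ₗ-closed r t
    }
    where
    module S = Subspace S
    module T = Subspace T

  combination : ∀ {d} → Vector Carrier d → Vector Carrierᴹ d → Carrierᴹ
  combination r v = sum (λ i → r i *ₗ v i)

  LinearlyIndependent : ∀ {d} → Vector Carrierᴹ d → Set (c ⊔ ℓ₁ ⊔ ℓ)
  LinearlyIndependent v = ∀ r → combination r v ≈ᴹ 0ᴹ → ∀ i → r i ≈ 0#

  record IsBasis (S : Subspace) {d : ℕ} (v : Vector Carrierᴹ d) :
                 Set (c ⊔ ℓ₁ ⊔ a ⊔ ℓ) where
    field
      inside      : ∀ i → v i ∈ member S
      independent : LinearlyIndependent v
      spanning    : ∀ {x} → x ∈ member S → ∃ λ r → x ≈ᴹ combination r v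

  HasDim : Subspace → ℕ → Set (c ⊔ ℓ₁ ⊔ a ⊔ ℓ)
  HasDim S d = ∃ λ (v : Vector Carrierᴹ d) → IsBasis S v

  HasDim≤ : Subspace → ℕ → Set (c ⊔ ℓ₁ ⊔ a ⊔ ℓ)
  HasDim≤ S h = ∃ λ d → d ℕ.≤ h × HasDim S d

  -- A collection of subspaces is a predicate on Subspace. Subspaces with the
  -- same vectors are the same subspace, hence the field resp-≋ and the use of
  -- _≋_ for distinctness and uniqueness of members.
  Collection : Set (suc (c ⊔ ℓ₁ ⊔ a ⊔ ℓ))
  Collection = Pred Subspace (c ⊔ ℓ₁ ⊔ a ⊔ ℓ)

  record IsSpread (m : ℕ) (𝒜 : Collection) : Set (suc (c ⊔ ℓ₁ ⊔ a ⊔ ℓ)) where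
    field
      resp-≋       : 𝒜 Respects _≋_
      dimension    : ∀ {S} → S ∈ 𝒜 → HasDim S m
      disjoint     : ∀ {S T} → S ∈ 𝒜 → T ∈ 𝒜 → ¬ (S ≋ T) →
                     ∀ {x} → x ∈ member S → x ∈ member T → x ≈ᴹ 0ᴹ
      partitioning : ∀ x → ¬ (x ≈ᴹ 0ᴹ) → ∃! _≋_ λ S → S ∈ 𝒜 × x ∈ member S

  IsEvasive : Collection → ℕ → Subspace → Set (suc (c ⊔ ℓ₁ ⊔ a ⊔ ℓ))
  IsEvasive 𝒜 h U = ∀ {S} → S ∈ 𝒜 → HasDim≤ (U ∩ S) h

-- Let σ be x ↦ x ^ q on the field K with q ^ m elements, and identify X with
-- K ^ (n - 1) × K.  Write pivot x for the first non-zero coordinate of x.  The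
-- bijection (x , y) ↦ (x , y + σ (pivot x)) is F-linear on each preimage of a
-- K-line, so these preimages form a spread.  Let U consist of the (x , y) such
-- that y lies in a fixed (h - 1)-dimensional subspace of K.  On the preimage of
-- the line through (x , b), parametrised by t, the coordinate y is t b + σ t c
-- with c = - σ (pivot x).  Two zeros of this map have a ratio fixed by σ, hence
-- in F, so the kernel has dimension at most 1, and U meets the spread element
-- in dimension at most h.
--
-- The field K is built as F[T] / Ann δ for a sequence δ of period q ^ m - 1 over
-- F on which T acts as the shift.  Every y in this ring satisfies y ^ (q ^ m) = y,
-- so replacing δ by z δ ≠ 0 makes z invertible; doing this for all z that do not
-- annihilate δ yields a field.  If this was first done for z = T ^ (q ^ d) - T
-- with 1 ≤ d < m, then Fermat's theorem excludes the degrees below m, and counting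
-- the roots of y ^ (q ^ m) - y excludes those above m.
module Submission where

open import Defs
open import Algebra.Apartness.Bundles using (HeytingField)
open import Algebra.Bundles using (CommutativeRing)
open import Algebra.Module.Bundles using (Module)
open import Algebra.Module.Structures.Biased using (IsModuleFromLeft)
open import Data.Fin.Base
  using (Fin; zero; suc; toℕ; fromℕ; fromℕ<; inject₁; inject≤; finToFun; funToFin; splitAt; remQuot; combine; _↑ˡ_; _↑ʳ_)
open import Data.Fin.Permutation using (Permutation; permutation)
import Data.Fin.Properties as Finₚ
open import Data.List.Base as List using (List; []; _∷_; tabulate)
open import Data.Nat.Base as ℕ using (ℕ; zero; suc)
open import Data.Nat.Combinatorics using (_C_; nCk+nC[k+1]≡[n+1]C[k+1]; nC1≡n; k>n⇒nCk≡0; nCn≡1)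
open import Data.Nat.Divisibility using (_∣_; divides; ∣⇒≤)
open import Data.Nat.DivMod using (_%_; _/_; m≡m%n+[m/n]*n; m%n<n; m<n⇒m%n≡m; [m+n]%n≡m%n)
open import Data.Nat.Primality using (Prime; euclidsLemma; prime⇒nonZero)
import Data.Nat.Properties as ℕₚ
open import Data.Product using (∃; ∃!; ∃₂; _×_; _,_; proj₁; proj₂; uncurry)
open import Data.Sum.Base using (_⊎_; inj₁; inj₂; [_,_]′)
open import Data.Vec.Functional using (Vector) renaming (_∷_ to _∷ᵛ_)
open import Data.Vec.Functional.Relation.Binary.Equality.Setoid using (≋-setoid)
open import Function.Base using (_∘_; id)
open import Function.Bundles using (Inverse)
open import Function.Properties.Bijection using (Bijection⇒Inverse)
open import Level using (_⊔_; Lift; lift; lower)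
open import Relation.Binary.Bundles using (Setoid)
open import Relation.Binary.Definitions using (_Respects_)
open import Relation.Binary.PropositionalEquality using (_≡_)
import Relation.Binary.PropositionalEquality as ≡
import Relation.Binary.Reasoning.Setoid as SetoidReasoning
open import Relation.Nullary.Decidable using (Dec; yes; no; map′; ¬?; _→-dec_; _×-dec_; decidable-stable)
open import Relation.Nullary.Negation using (¬_; contradiction)
open import Relation.Unary using (Pred; Decidable; _∈_)

-- The `K`-lines themselves would form a spread, but `U` contains `K ^ (n - 1) × 0` and with it
-- whole lines, of dimension `m`, which is too much once `h < m`. The twist puts a term `σ t c` with
-- `c ≠ 0` on every line with `x ≠ 0`. For that a function `f` of `x` is wanted that vanishes at 0
-- only and satisfies `f (t x) = σ t f x`, which makes it F-linear along each `K`-line. A map to `K`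
-- that is F-linear on all of `K ^ (n - 1)` has a non-trivial kernel as soon as `n > 2`; `σ ∘ pivot`
-- has both properties. On the line with `x = 0` the twist vanishes, but then `b ≠ 0`.
--
-- Passing from `δ` to `z δ` replaces `Ann δ` by the larger ideal of all `f` with `f z` in `Ann δ`.
-- Units therefore stay units and zeros stay zero, and a maximal ideal is reached without a search
-- for irreducible polynomials. The danger is that the quotient becomes too small. The
-- `T ^ (q ^ d) - T` with `1 ≤ d < m` can be made units beforehand because their product has degree
-- `q + ... + q ^ (m - 1)`, less than the period `q ^ m - 1`, so some periodic sequence is not
-- killed by it.

-- Finite setoids

Finite : ∀ {a ℓ} → Setoid a ℓ → ℕ → Set (a ⊔ ℓ)
Finite S N = Inverse (≡.setoid (Fin N)) S

module FiniteSetoid {a ℓ} {S : Setoid a ℓ} {N : ℕ} (finite : Finite S N) where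
  open Setoid S
  open Inverse finite public using (to; from; from-cong)

  to-from : ∀ x → to (from x) ≈ x
  to-from x = Inverse.inverseˡ finite ≡.refl

  from-to : ∀ i → from (to i) ≡ i
  from-to i = Inverse.inverseʳ finite refl

  from-injective : ∀ {x y} → from x ≡ from y → x ≈ y
  from-injective {x} {y} eq =
    trans (sym (to-from x)) (trans (reflexive (≡.cong to eq)) (to-from y))

  infix 4 _≟_
  _≟_ : ∀ x y → Dec (x ≈ y)
  x ≟ y = map′ from-injective from-cong (from x Finₚ.≟ from y)

  ∃? : ∀ {p} {P : Pred Carrier p} → P Respects _≈_ → Decidable P → Dec (∃ P)
  ∃? {P = P} resp P? = map′ (λ (i , p) → to i , p)
    (λ (x , p) → from x , resp (sym (to-from x)) p) (Finₚ.any? (λ i → P? (to i)))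

  permute : (f g : Carrier → Carrier) → (∀ {x y} → x ≈ y → f x ≈ f y) →
            (∀ {x y} → x ≈ y → g x ≈ g y) →
            (∀ x → f (g x) ≈ x) → (∀ x → g (f x) ≈ x) → Permutation N N
  permute f g f-cong g-cong fg gf = permutation
    (λ i → from (f (to i))) (λ i → from (g (to i)))
    (λ i → ≡.trans (from-cong (trans (f-cong (to-from _)) (fg _))) (from-to i))
    (λ i → ≡.trans (from-cong (trans (g-cong (to-from _)) (gf _))) (from-to i))

injection⇒≤ : ∀ {a b ℓ ℓ′} {S : Setoid a ℓ} {T : Setoid b ℓ′} {M N} →
              Finite S M → Finite T N →
              (f : Setoid.Carrier S → Setoid.Carrier T) →
              (∀ x y → Setoid._≈_ T (f x) (f y) → Setoid._≈_ S x y) → M ℕ.≤ N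
injection⇒≤ {S = S} finS finT f inj = Finₚ.injective⇒≤ {f = FT.from ∘ f ∘ FS.to} λ eq →
  ≡.trans (≡.sym (FS.from-to _))
    (≡.trans (FS.from-cong (inj _ _ (FT.from-injective eq))) (FS.from-to _))
  where
  module FS = FiniteSetoid finS
  module FT = FiniteSetoid finT

vector-finite : ∀ {a ℓ} {S : Setoid a ℓ} {N} → Finite S N →
                ∀ d → Finite (≋-setoid S d) (N ℕ.^ d)
vector-finite {S = S} {N} fin d = record
  { to        = λ i j → to (finToFun {N} {d} i j)
  ; from      = λ v → funToFin (λ j → from (v j))
  ; to-cong   = λ { ≡.refl j → refl }
  ; from-cong = λ eq → funToFin-cong (λ j → from-cong (eq j))
  ; inverse   =
      (λ { ≡.refl j → trans (reflexive (≡.cong to (Finₚ.finToFun-funToFin _ j))) (to-from _) })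
    , (λ eq → ≡.trans
        (funToFin-cong (λ j → ≡.trans (from-cong (eq j)) (from-to _)))
        (Finₚ.funToFin-finToFin {m = d} {n = N} _))
  }
  where
  open Setoid S
  open FiniteSetoid fin
  funToFin-cong : ∀ {d M} {f g : Fin d → Fin M} → (∀ j → f j ≡ g j) → funToFin f ≡ funToFin g
  funToFin-cong {zero}  eq = ≡.refl
  funToFin-cong {suc d} eq = ≡.cong₂ combine (eq zero) (funToFin-cong (eq ∘ suc))

-- Commutative rings

-- The absorption identity `(k + 1) C(p, k + 1) = p C(p - 1, k)` shows that `p` divides the
-- left-hand product. By Euclid's lemma it divides a factor, and `k + 1` is positive and smaller
-- than `p`.
prime∣binomial : ∀ {p} → Prime p → ∀ k → suc k ℕ.< p → p ∣ p C suc k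
prime∣binomial {suc p} pp k k<p
  with euclidsLemma (suc k) (suc p C suc k) pp (divides (p C k) eq)
  where
  absorb : ∀ n k → suc k ℕ.* (suc n C suc k) ≡ suc n ℕ.* (n C k)
  absorb zero zero = ≡.refl
  absorb zero (suc k) = ≡.trans
    (≡.cong (suc (suc k) ℕ.*_) (k>n⇒nCk≡0 {1} {suc (suc k)} (ℕ.s≤s (ℕ.s≤s ℕ.z≤n))))
    (≡.trans (ℕₚ.*-zeroʳ (suc (suc k)))
      (≡.sym (≡.trans (ℕₚ.*-identityˡ _) (k>n⇒nCk≡0 {0} {suc k} (ℕ.s≤s ℕ.z≤n)))))
  absorb (suc n) zero = ≡.trans (ℕₚ.*-identityˡ _) (≡.trans (nC1≡n (suc (suc n))) (≡.sym (ℕₚ.*-identityʳ _)))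
  absorb (suc n) (suc k) =
    ≡.trans (≡.cong (suc (suc k) ℕ.*_) (≡.sym (nCk+nC[k+1]≡[n+1]C[k+1] (suc n) (suc k))))
    (≡.trans (ℕₚ.*-distribˡ-+ (suc (suc k)) A B)
    (≡.trans (≡.cong₂ ℕ._+_ (≡.cong (A ℕ.+_) (absorb n k)) (absorb n (suc k)))
    (≡.trans (ℕₚ.+-assoc A _ _)
    (≡.trans (≡.cong (A ℕ.+_) (≡.sym (ℕₚ.*-distribˡ-+ (suc n) (n C k) (n C suc k))))
    (≡.cong (λ z → A ℕ.+ suc n ℕ.* z) (nCk+nC[k+1]≡[n+1]C[k+1] n k))))))
    where
    A = suc n C suc k
    B = suc n C suc (suc k)
  eq : suc k ℕ.* (suc p C suc k) ≡ (p C k) ℕ.* suc p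
  eq = ≡.trans (absorb p k) (ℕₚ.*-comm (suc p) _)
... | inj₁ p∣k = contradiction (∣⇒≤ p∣k) (ℕₚ.<⇒≱ k<p)
... | inj₂ p∣C = p∣C

module RingLemmas {c ℓ} (R : CommutativeRing c ℓ) where
  open CommutativeRing R hiding (zero)
  open import Algebra.Properties.Ring ring public
    using (-‿distribˡ-*; -‿distribʳ-*)
  open import Algebra.Properties.AbelianGroup +-abelianGroup public
    using () renaming (x∙y⁻¹≈ε⇒x≈y to x-y≈0⇒x≈y; x≈y⇒x∙y⁻¹≈ε to x≈y⇒x-y≈0; ε⁻¹≈ε to -0≈0; xyx⁻¹≈y to x+y-x≈y)
  open import Algebra.Properties.CommutativeSemiring.Exp commutativeSemiring public
    using (_^_; ^-congˡ; ^-assocʳ; ^-distrib-*)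
  open import Algebra.Properties.Semiring.Mult semiring public
    using (×-congʳ; ×-assocˡ; ×1-homo-*; ×-assoc-*)
    renaming (_×_ to _·_)
  open import Algebra.Properties.CommutativeMonoid.Sum +-commutativeMonoid public
    using (sum; sum-init-last; sum-cong-≋; sum-replicate-zero; sum-permute; ∑-distrib-+; sum-replicate)
  open import Algebra.Solver.Ring.NaturalCoefficients.Default commutativeSemiring public
    using (solve; _:=_; _:+_; _:*_)
  open SetoidReasoning setoid

  0^n≈0 : ∀ n .{{_ : ℕ.NonZero n}} → 0# ^ n ≈ 0#
  0^n≈0 (suc n) = zeroˡ _

  1^n≈1 : ∀ n → 1# ^ n ≈ 1#
  1^n≈1 zero    = refl
  1^n≈1 (suc n) = trans (*-identityˡ _) (1^n≈1 n)

  x-y+y≈x : ∀ x y → (x - y) + y ≈ x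
  x-y+y≈x x y = trans (+-assoc _ _ _) (trans (+-congˡ (-‿inverseˡ y)) (+-identityʳ x))

  x+y-y≈x : ∀ x y → (x + y) - y ≈ x
  x+y-y≈x x y = trans (+-assoc _ _ _) (trans (+-congˡ (-‿inverseʳ y)) (+-identityʳ x))

  x-0≈x : ∀ x → x - 0# ≈ x
  x-0≈x x = trans (+-congˡ -0≈0) (+-identityʳ x)

  module Characteristic {p} (pp : Prime p) (p·1≈0 : p · 1# ≈ 0#) where
    open import Algebra.Properties.CommutativeSemiring.Binomial commutativeSemiring
      using (theorem; binomial; binomialTerm)

    p∣n⇒n·x≈0 : ∀ {n} x → p ∣ n → n · x ≈ 0#
    p∣n⇒n·x≈0 x (divides k ≡.refl) = begin
      (k ℕ.* p) · x          ≈⟨ ×-assocˡ x k p ⟨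
      k · (p · x)            ≈⟨ ×-congʳ k (×-congʳ p (*-identityˡ x)) ⟨
      k · (p · (1# * x))     ≈⟨ ×-congʳ k (×-assoc-* p 1# x) ⟨
      k · ((p · 1#) * x)     ≈⟨ ×-congʳ k (trans (*-congʳ p·1≈0) (zeroˡ x)) ⟩
      k · 0#                 ≈⟨ sum-replicate k ⟨
      sum {k} (λ _ → 0#)     ≈⟨ sum-replicate-zero k ⟩
      0#                     ∎

    ^p-distrib-+ : ∀ x y → (x + y) ^ p ≈ x ^ p + y ^ p
    ^p-distrib-+ x y = go p ≡.refl
      where
      -- The exponent is generalised so that it can be matched as `suc n`; the binomial sum then
      -- splits into its first, inner and last terms, and the inner ones vanish.
      go : ∀ n → n ≡ p → (x + y) ^ n ≈ x ^ n + y ^ n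
      go zero    0≡p = contradiction (≡.sym 0≡p) (ℕ.≢-nonZero⁻¹ p {{prime⇒nonZero pp}})
      go (suc n) n≡p = begin
        (x + y) ^ suc n
          ≈⟨ theorem (suc n) x y ⟩
        t zero + sum (t ∘ suc)
          ≈⟨ +-cong first (sum-init-last (t ∘ suc)) ⟩
        y ^ suc n + (sum (t ∘ suc ∘ inject₁) + t (suc (fromℕ n)))
          ≈⟨ +-congˡ (+-cong (trans (sum-cong-≋ inner) (sum-replicate-zero n)) last) ⟩
        y ^ suc n + (0# + x ^ suc n)
          ≈⟨ +-congˡ (+-identityˡ _) ⟩
        y ^ suc n + x ^ suc n
          ≈⟨ +-comm _ _ ⟩
        x ^ suc n + y ^ suc n ∎
        where
        t = binomialTerm x y (suc n)
        first : t zero ≈ y ^ suc n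
        first = trans (+-identityʳ _) (*-identityˡ _)
        inner : ∀ (i : Fin n) → t (suc (inject₁ i)) ≈ 0#
        inner i = p∣n⇒n·x≈0 (binomial x y (suc n) (suc (inject₁ i)))
          (≡.subst (λ n → p ∣ n C suc (toℕ (inject₁ i))) (≡.sym n≡p)
            (prime∣binomial pp (toℕ (inject₁ i))
              (≡.subst₂ ℕ._<_ (≡.cong suc (≡.sym (Finₚ.toℕ-inject₁ i))) n≡p (ℕ.s≤s (Finₚ.toℕ<n i)))))
        last : t (suc (fromℕ n)) ≈ x ^ suc n
        last rewrite Finₚ.toℕ-fromℕ n | nCn≡1 (suc n) | ℕₚ.n∸n≡0 n =
          trans (+-identityʳ _) (*-identityʳ _)

    ^p^k-distrib-+ : ∀ k x y → (x + y) ^ (p ℕ.^ k) ≈ x ^ (p ℕ.^ k) + y ^ (p ℕ.^ k)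
    ^p^k-distrib-+ zero x y = trans (*-identityʳ _) (sym (+-cong (*-identityʳ _) (*-identityʳ _)))
    ^p^k-distrib-+ (suc k) x y = begin
      (x + y) ^ (p ℕ.* p ℕ.^ k)        ≈⟨ ^-assocʳ _ p (p ℕ.^ k) ⟨
      ((x + y) ^ p) ^ (p ℕ.^ k)        ≈⟨ ^-congˡ (p ℕ.^ k) (^p-distrib-+ x y) ⟩
      (x ^ p + y ^ p) ^ (p ℕ.^ k)      ≈⟨ ^p^k-distrib-+ k _ _ ⟩
      (x ^ p) ^ (p ℕ.^ k) + (y ^ p) ^ (p ℕ.^ k)
        ≈⟨ +-cong (^-assocʳ x p (p ℕ.^ k)) (^-assocʳ y p (p ℕ.^ k)) ⟩
      x ^ (p ℕ.* p ℕ.^ k) + y ^ (p ℕ.* p ℕ.^ k) ∎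

-- Finite fields

record IsFiniteField {c ℓ} (R : CommutativeRing c ℓ) (s : ℕ) : Set (c ⊔ ℓ) where
  open CommutativeRing R
  field
    finite : Finite setoid s
    1≉0    : ¬ (1# ≈ 0#)
    invert : ∀ x → ¬ (x ≈ 0#) → ∃ λ y → x * y ≈ 1#

module FiniteField {c ℓ} {R : CommutativeRing c ℓ} {s} (isFiniteField : IsFiniteField R s) where
  open CommutativeRing R hiding (zero)
  open RingLemmas R
  open IsFiniteField isFiniteField public
  open FiniteSetoid finite public
  open SetoidReasoning setoid
  open import Algebra.Properties.CommutativeMonoid.Sum *-commutativeMonoid
    using () renaming (sum to product; sum-permute to product-permute; ∑-distrib-+ to product-distrib;
      sum-cong-≋ to product-cong; sum-replicate to product-replicate)

  cancelˡ : ∀ x {y z} → ¬ (x ≈ 0#) → x * y ≈ x * z → y ≈ z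
  cancelˡ x {y} {z} x≉0 xy≈xz with x⁻¹ , xx⁻¹≈1 ← invert x x≉0 = begin
    y              ≈⟨ undo y ⟨
    x⁻¹ * (x * y)  ≈⟨ *-congˡ xy≈xz ⟩
    x⁻¹ * (x * z)  ≈⟨ undo z ⟩
    z              ∎
    where
    undo : ∀ y → x⁻¹ * (x * y) ≈ y
    undo y = trans (sym (*-assoc _ _ _))
      (trans (*-congʳ (trans (*-comm _ _) xx⁻¹≈1)) (*-identityˡ y))

  x≉0∧xy≈0⇒y≈0 : ∀ {x y} → ¬ (x ≈ 0#) → x * y ≈ 0# → y ≈ 0#
  x≉0∧xy≈0⇒y≈0 x≉0 xy≈0 = cancelˡ _ x≉0 (trans xy≈0 (sym (zeroʳ _)))

  x^n≈0⇒x≈0 : ∀ {x} n → x ^ n ≈ 0# → x ≈ 0#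
  x^n≈0⇒x≈0 zero 1≈0 = contradiction 1≈0 1≉0
  x^n≈0⇒x≈0 {x} (suc n) x^n≈0 with x ≟ 0#
  ... | yes x≈0 = x≈0
  ... | no  x≉0 = x^n≈0⇒x≈0 n (x≉0∧xy≈0⇒y≈0 x≉0 x^n≈0)

  2≤s : 2 ℕ.≤ s
  2≤s = go s from (λ eq → 1≉0 (from-injective eq))
    where
    go : ∀ n (f : Carrier → Fin n) → ¬ (f 1# ≡ f 0#) → 2 ℕ.≤ n
    go zero f _ with () ← f 0#
    go (suc zero) f f1≢f0 with f 0# | f 1#
    ... | zero | zero = contradiction ≡.refl f1≢f0
    go (suc (suc n)) f _ = ℕ.s≤s (ℕ.s≤s ℕ.z≤n)

  2≤s^ : ∀ n → 2 ℕ.≤ s ℕ.^ suc n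
  2≤s^ n = ℕₚ.≤-trans 2≤s (ℕₚ.≤-trans (ℕₚ.≤-reflexive (≡.sym (ℕₚ.*-identityʳ s)))
    (ℕₚ.*-monoʳ-≤ s (ℕₚ.m^n>0 s {{ℕ.>-nonZero (ℕₚ.≤-trans (ℕ.s≤s ℕ.z≤n) 2≤s)}} n)))

  -- The sum of all elements is invariant under translation by 1.
  s·1≈0 : s · 1# ≈ 0#
  s·1≈0 = begin
    s · 1#                            ≈⟨ x+y-x≈y (sum to) _ ⟨
    (sum to + s · 1#) - sum to        ≈⟨ +-congʳ shifted ⟨
    sum to - sum to                   ≈⟨ -‿inverseʳ _ ⟩
    0#                                ∎
    where
    shifted : sum to ≈ sum to + s · 1#
    shifted = begin
      sum to
        ≈⟨ sum-permute to (permute (_+ 1#) (_- 1#) +-congʳ +-congʳ (λ x → x-y+y≈x x 1#) (λ x → x+y-y≈x x 1#)) ⟩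
      sum (λ i → to (from (to i + 1#)))
        ≈⟨ sum-cong-≋ (λ i → to-from (to i + 1#)) ⟩
      sum (λ i → to i + 1#)
        ≈⟨ ∑-distrib-+ to (λ _ → 1#) ⟩
      sum to + sum {s} (λ _ → 1#)
        ≈⟨ +-congˡ (sum-replicate s) ⟩
      sum to + s · 1# ∎

  -- For x ≠ 0, multiplication by x permutes the factors of the product of all
  -- non-zero elements; zero is replaced by 1 there, and the factor x that this
  -- loses is restored by the product of atZero, which is x.
  fermat : ∀ x → x ^ s ≈ x
  fermat x with x ≟ 0#
  ... | yes x≈0 = trans (^-congˡ s x≈0) (trans (0^n≈0 s {{ℕ.>-nonZero (ℕₚ.≤-trans (ℕ.s≤s ℕ.z≤n) 2≤s)}}) (sym x≈0))
  ... | no  x≉0 with x⁻¹ , xx⁻¹≈1 ← invert x x≉0 = begin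
    x ^ s                                          ≈⟨ product-replicate s ⟨
    product {s} (λ _ → x)                          ≈⟨ product-cong (λ i → split (to i)) ⟨
    product (λ i → atZero (to i) * offZero (to i)) ≈⟨ product-distrib (atZero ∘ to) (offZero ∘ to) ⟩
    product (atZero ∘ to) * product (offZero ∘ to) ≈⟨ *-cong at≈x off≈1 ⟩
    x * 1#                                         ≈⟨ *-identityʳ x ⟩
    x                                              ∎
    where
    ifZero : Carrier → Carrier → Carrier → Carrier
    ifZero a b y with y ≟ 0#
    ... | yes _ = a
    ... | no  _ = b

    ifZero-yes : ∀ a b {y} → y ≈ 0# → ifZero a b y ≈ a
    ifZero-yes a b {y} y≈0 with y ≟ 0#
    ... | yes _   = refl
    ... | no  y≉0 = contradiction y≈0 y≉0

    ifZero-no : ∀ a b {y} → ¬ (y ≈ 0#) → ifZero a b y ≈ b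
    ifZero-no a b {y} y≉0 with y ≟ 0#
    ... | yes y≈0 = contradiction y≈0 y≉0
    ... | no  _   = refl

    atZero offZero nonZero : Carrier → Carrier
    atZero    = ifZero x 1#
    offZero   = ifZero 1# x
    nonZero y = ifZero 1# y y

    split : ∀ y → atZero y * offZero y ≈ x
    split y with y ≟ 0#
    ... | yes _ = *-identityʳ x
    ... | no  _ = *-identityˡ x

    delta : ∀ {n} (f : Fin n → Carrier) (i : Fin n) → f i ≈ 0# → (∀ j → f j ≈ 0# → j ≡ i) →
            product (atZero ∘ f) ≈ x
    delta {suc n} f zero fi≈0 uniq = trans
      (*-cong (ifZero-yes x 1# fi≈0)
        (trans (product-cong (λ j → ifZero-no x 1# (λ eq → case (uniq (suc j) eq)))) (trans (product-replicate n) (1^n≈1 n))))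
      (*-identityʳ x)
      where
      case : ∀ {n} {j : Fin n} → ¬ (suc j ≡ zero)
      case ()
    delta f (suc i) fi≈0 uniq = trans
      (*-cong (ifZero-no x 1# (λ eq → case (uniq zero eq)))
        (delta (f ∘ suc) i fi≈0 (λ j eq → Finₚ.suc-injective (uniq (suc j) eq))))
      (*-identityˡ x)
      where
      case : ¬ (zero ≡ suc i)
      case ()

    at≈x : product (atZero ∘ to) ≈ x
    at≈x = delta to (from 0#) (to-from 0#) (λ j eq → ≡.trans (≡.sym (from-to j)) (from-cong eq))

    nonZero-cong : ∀ {y z} → y ≈ z → nonZero y ≈ nonZero z
    nonZero-cong {y} {z} y≈z with y ≟ 0# | z ≟ 0#
    ... | yes _   | yes _   = refl
    ... | no  _   | no  _   = y≈z
    ... | yes y≈0 | no  z≉0 = contradiction (trans (sym y≈z) y≈0) z≉0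
    ... | no  y≉0 | yes z≈0 = contradiction (trans y≈z z≈0) y≉0

    -- Holds at `y = 0` as well, where both sides are 1; the default values in `nonZero` and
    -- `offZero` are chosen for this.
    scale : ∀ y → nonZero (x * y) ≈ offZero y * nonZero y
    scale y with y ≟ 0#
    ... | yes y≈0 = trans (ifZero-yes _ _ (trans (*-congˡ y≈0) (zeroʳ x))) (sym (*-identityˡ _))
    ... | no  y≉0 = ifZero-no _ _ (y≉0 ∘ x≉0∧xy≈0⇒y≈0 x≉0)

    P = product (nonZero ∘ to)

    product≉0 : ∀ {n} (f : Fin n → Carrier) → (∀ i → ¬ (f i ≈ 0#)) → ¬ (product f ≈ 0#)
    product≉0 {zero}  f f≉0 = 1≉0
    product≉0 {suc n} f f≉0 = product≉0 (f ∘ suc) (f≉0 ∘ suc) ∘ x≉0∧xy≈0⇒y≈0 (f≉0 zero)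

    P≉0 : ¬ (P ≈ 0#)
    P≉0 = product≉0 (nonZero ∘ to) (λ i → nonZero≉0 (to i))
      where
      nonZero≉0 : ∀ y → ¬ (nonZero y ≈ 0#)
      nonZero≉0 y with y ≟ 0#
      ... | yes _   = 1≉0
      ... | no  y≉0 = y≉0

    off≈1 : product (offZero ∘ to) ≈ 1#
    off≈1 = cancelˡ P P≉0 (sym (begin
      P * 1#                                           ≈⟨ *-identityʳ P ⟩
      P                                                ≈⟨ product-permute (nonZero ∘ to) x*-permutation ⟩
      product (λ i → nonZero (to (from (x * to i))))   ≈⟨ product-cong scaleᵢ ⟩
      product (λ i → offZero (to i) * nonZero (to i))  ≈⟨ product-distrib (offZero ∘ to) (nonZero ∘ to) ⟩
      product (offZero ∘ to) * P                       ≈⟨ *-comm _ _ ⟩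
      P * product (offZero ∘ to)                       ∎))
      where
      unscale : ∀ {a b} y → a * b ≈ 1# → a * (b * y) ≈ y
      unscale y ab≈1 = trans (sym (*-assoc _ _ _)) (trans (*-congʳ ab≈1) (*-identityˡ y))
      x*-permutation : Permutation s s
      x*-permutation = permute (x *_) (x⁻¹ *_) *-congˡ *-congˡ
        (λ y → unscale y xx⁻¹≈1) (λ y → unscale y (trans (*-comm _ _) xx⁻¹≈1))
      scaleᵢ : ∀ i → nonZero (to (from (x * to i))) ≈ offZero (to i) * nonZero (to i)
      scaleᵢ i = trans (nonZero-cong (to-from _)) (scale (to i))

  -- The `k`-th power of `p · 1#` is `s · 1#`, which vanishes, and a field has no non-zero
  -- nilpotents.
  ^-p·1 : ∀ p k → s ≡ p ℕ.^ k → p · 1# ≈ 0#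
  ^-p·1 p k ≡.refl = x^n≈0⇒x≈0 k (trans (sym (pow k)) s·1≈0)
    where
    pow : ∀ k → (p ℕ.^ k) · 1# ≈ (p · 1#) ^ k
    pow zero    = +-identityʳ 1#
    pow (suc k) = trans (×1-homo-* p (p ℕ.^ k)) (*-congˡ (pow k))

  -- f is a polynomial function of degree at most n whose coefficient at degree n is a.
  Polynomial : ℕ → Carrier → (Carrier → Carrier) → Set (c ⊔ ℓ)
  Polynomial zero    a f = ∀ x → f x ≈ a
  Polynomial (suc n) a f = ∀ r → ∃ λ g → Polynomial n a g × (∀ x → f x ≈ f r + (x - r) * g x)

  polynomial-+ : ∀ n {a b f g} → Polynomial n a f → Polynomial n b g → Polynomial n (a + b) (λ x → f x + g x)
  polynomial-+ zero    pf pg x = +-cong (pf x) (pg x)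
  polynomial-+ (suc n) {f = f} {g} pf pg r with f′ , pf′ , ff′ ← pf r | g′ , pg′ , gg′ ← pg r =
    (λ x → f′ x + g′ x) , polynomial-+ n pf′ pg′ , λ x → trans (+-cong (ff′ x) (gg′ x))
      (solve 5 (λ a b c d e → (a :+ c :* d) :+ (b :+ c :* e) := (a :+ b) :+ c :* (d :+ e)) refl
        (f r) (g r) (x - r) (f′ x) (g′ x))

  polynomial-scale : ∀ n b {a f} → Polynomial n a f → Polynomial n (b * a) (λ x → b * f x)
  polynomial-scale zero    b pf x = *-congˡ (pf x)
  polynomial-scale (suc n) b {f = f} pf r with f′ , pf′ , ff′ ← pf r =
    (λ x → b * f′ x) , polynomial-scale n b pf′ , λ x → trans (*-congˡ (ff′ x))
      (solve 4 (λ a b c d → b :* (a :+ c :* d) := b :* a :+ c :* (b :* d)) refl (f r) b (x - r) (f′ x))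

  polynomial-lead : ∀ n {a b f} → a ≈ b → Polynomial n a f → Polynomial n b f
  polynomial-lead zero    a≈b pf x = trans (pf x) a≈b
  polynomial-lead (suc n) a≈b pf r with f′ , pf′ , ff′ ← pf r = f′ , polynomial-lead n a≈b pf′ , ff′

  polynomial-raise : ∀ n {a f} → Polynomial n a f → Polynomial (suc n) 0# f
  polynomial-raise zero    {f = f} pf r = (λ _ → 0#) , (λ _ → refl) ,
    λ x → trans (trans (pf x) (sym (pf r))) (sym (trans (+-congˡ (zeroʳ _)) (+-identityʳ _)))
  polynomial-raise (suc n) pf r with f′ , pf′ , ff′ ← pf r = f′ , polynomial-raise n pf′ , ff′

  polynomial-shift : ∀ n {a f} → Polynomial n a f → Polynomial (suc n) a (λ x → x * f x)
  polynomial-shift zero {f = f} pf r = f , pf , λ x → begin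
    x * f x                  ≈⟨ *-congʳ (x-y+y≈x x r) ⟨
    ((x - r) + r) * f x      ≈⟨ distribʳ _ _ _ ⟩
    (x - r) * f x + r * f x  ≈⟨ +-comm _ _ ⟩
    r * f x + (x - r) * f x  ≈⟨ +-congʳ (*-congˡ (trans (pf x) (sym (pf r)))) ⟩
    r * f r + (x - r) * f x  ∎
  polynomial-shift (suc n) {f = f} pf r with f′ , pf′ , ff′ ← pf r =
    -- From `f x = f r + (x - r) f′ x` one gets `x f x - r f r = (x - r) (f x + r f′ x)`. The
    -- summand `r f′` has lower degree, so the leading coefficient is that of `f`.
    (λ x → f x + r * f′ x) ,
    polynomial-lead (suc n) (+-identityʳ _) (polynomial-+ (suc n) pf (polynomial-raise n (polynomial-scale n r pf′))) ,
    λ x → begin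
      x * f x                                        ≈⟨ *-congʳ (x-y+y≈x x r) ⟨
      ((x - r) + r) * f x                            ≈⟨ distribʳ _ _ _ ⟩
      (x - r) * f x + r * f x                        ≈⟨ +-congˡ (*-congˡ (ff′ x)) ⟩
      (x - r) * f x + r * (f r + (x - r) * f′ x)     ≈⟨ solve 5 (λ d fx r fr f′ →
                                                            d :* fx :+ r :* (fr :+ d :* f′) := r :* fr :+ d :* (fx :+ r :* f′))
                                                          refl (x - r) (f x) r (f r) (f′ x) ⟩
      r * f r + (x - r) * (f x + r * f′ x)           ∎

  polynomial-^ : ∀ n → Polynomial n 1# (_^ n)
  polynomial-^ zero    x = refl
  polynomial-^ (suc n) = polynomial-shift n (polynomial-^ n)

  -- From `n = 2` on, the linear term lies below the top degree and leaves the leading coefficient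
  -- 1; at `n = 1` the function would be zero.
  polynomial-x^n-x : ∀ {n} → 2 ℕ.≤ n → Polynomial n 1# (λ x → x ^ n + - 1# * x)
  polynomial-x^n-x {suc zero} (ℕ.s≤s ())
  polynomial-x^n-x {suc (suc n)} _ = polynomial-lead (suc (suc n)) (+-identityʳ _)
    (polynomial-+ (suc (suc n)) (polynomial-^ (suc (suc n))) (linear n))
    where
    linear : ∀ n → Polynomial (suc (suc n)) 0# (λ x → - 1# * x)
    linear zero    = polynomial-raise 1 (polynomial-scale 1 (- 1#) id-polynomial)
      where
      id-polynomial : Polynomial 1 1# (λ x → x)
      id-polynomial r = (λ _ → 1#) , (λ _ → refl) , λ x → sym (trans (+-congˡ (*-identityʳ _)) (trans (+-comm _ _) (x-y+y≈x x r)))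
    linear (suc n) = polynomial-raise (suc (suc n)) (linear n)

  -- Splitting off `x - r zero` leaves a quotient with the same leading coefficient that vanishes at
  -- the remaining roots, since these differ from `r zero`. At degree 0 the function is the constant
  -- 1.
  roots≤degree : ∀ n {f} → Polynomial n 1# f → ∀ {k} (r : Fin k → Carrier) →
                 (∀ i j → r i ≈ r j → i ≡ j) → (∀ i → f (r i) ≈ 0#) → k ℕ.≤ n
  roots≤degree n       pf {zero}  r inj root = ℕ.z≤n
  roots≤degree zero    pf {suc k} r inj root = contradiction (trans (sym (pf (r zero))) (root zero)) 1≉0
  roots≤degree (suc n) pf {suc k} r inj root with g , pg , fg ← pf (r zero) =
    ℕ.s≤s (roots≤degree n pg (r ∘ suc) (λ i j eq → Finₚ.suc-injective (inj _ _ eq)) λ i →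
      x≉0∧xy≈0⇒y≈0 (λ eq → case (inj (suc i) zero (x-y≈0⇒x≈y _ _ eq)))
        (trans (sym (trans (fg _) (trans (+-congʳ (root zero)) (+-identityˡ _)))) (root (suc i))))
    where
    case : ∀ {j : Fin k} → ¬ (suc j ≡ zero)
    case ()

  -- Serves twice: with exponent `q ^ m` it bounds the order of the extension field, with exponent
  -- `q` it identifies the elements fixed by `σ`.
  fixed-points≤ : ∀ {n} → 2 ℕ.≤ n → ∀ {k} (r : Fin k → Carrier) →
                  (∀ i j → r i ≈ r j → i ≡ j) → (∀ i → r i ^ n ≈ r i) → k ℕ.≤ n
  fixed-points≤ 2≤n r inj fixed = roots≤degree _ (polynomial-x^n-x 2≤n) r inj
    λ i → trans (+-cong (fixed i) (trans (sym (-‿distribˡ-* 1# (r i))) (-‿cong (*-identityˡ (r i))))) (-‿inverseʳ (r i))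

-- Linear algebra over a finite field

^-cancelˡ-≤ : ∀ {q} m n → 2 ℕ.≤ q → q ℕ.^ m ℕ.≤ q ℕ.^ n → m ℕ.≤ n
^-cancelˡ-≤ {q} m n 2≤q le with m ℕₚ.≤? n
... | yes m≤n = m≤n
... | no  m≰n = contradiction le (ℕₚ.<⇒≱ (ℕₚ.^-monoʳ-< q 2≤q (ℕₚ.≰⇒> m≰n)))

module LinearAlgebra {c ℓ₁ a ℓ} {R : CommutativeRing c ℓ₁} {q} (isFiniteField : IsFiniteField R q)
                     (X : Module R a ℓ) where
  open CommutativeRing R using (Carrier; _≈_; _+_; _*_; -_; _-_; 0#; 1#; setoid)
  private
    module F  = CommutativeRing R
    module FF = FiniteField isFiniteField
    module FL = RingLemmas R
  open Module X
  open SetoidReasoning ≈ᴹ-setoid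
  open import Algebra.Properties.CommutativeMonoid.Sum +ᴹ-commutativeMonoid using (sum; sum-cong-≋; ∑-distrib-+)

  infix 8 _⊙_
  _⊙_ : ∀ {d} → Vector Carrier d → Vector Carrierᴹ d → Carrierᴹ
  r ⊙ v = combination X r v

  ⊙-cong : ∀ {d} {r r′ : Vector Carrier d} {v v′ : Vector Carrierᴹ d} →
           (∀ i → r i ≈ r′ i) → (∀ i → v i ≈ᴹ v′ i) → r ⊙ v ≈ᴹ r′ ⊙ v′
  ⊙-cong r≈r′ v≈v′ = sum-cong-≋ (λ i → *ₗ-cong (r≈r′ i) (v≈v′ i))

  ⊙-congˡ : ∀ {d} {r r′ : Vector Carrier d} {v : Vector Carrierᴹ d} →
            (∀ i → r i ≈ r′ i) → r ⊙ v ≈ᴹ r′ ⊙ v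
  ⊙-congˡ r≈r′ = ⊙-cong r≈r′ (λ _ → ≈ᴹ-refl)

  ⊙-+ : ∀ {d} (r r′ : Vector Carrier d) (v : Vector Carrierᴹ d) →
        (λ i → r i + r′ i) ⊙ v ≈ᴹ r ⊙ v +ᴹ r′ ⊙ v
  ⊙-+ r r′ v = ≈ᴹ-trans (sum-cong-≋ (λ i → *ₗ-distribʳ (v i) (r i) (r′ i)))
    (∑-distrib-+ (λ i → r i *ₗ v i) (λ i → r′ i *ₗ v i))

  ⊙-* : ∀ {d} b (r : Vector Carrier d) (v : Vector Carrierᴹ d) →
        (λ i → b * r i) ⊙ v ≈ᴹ b *ₗ (r ⊙ v)
  ⊙-* {zero}  b r v = ≈ᴹ-sym (*ₗ-zeroʳ b)
  ⊙-* {suc d} b r v = ≈ᴹ-trans (+ᴹ-cong (*ₗ-assoc b (r zero) (v zero)) (⊙-* b (r ∘ suc) (v ∘ suc)))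
    (≈ᴹ-sym (*ₗ-distribˡ b _ _))

  ⊙-zero : ∀ {d} (r : Vector Carrier d) (v : Vector Carrierᴹ d) → (∀ i → r i ≈ 0#) → r ⊙ v ≈ᴹ 0ᴹ
  ⊙-zero r v r≈0 = ≈ᴹ-trans (⊙-congˡ (λ i → F.trans (r≈0 i) (F.sym (F.zeroˡ 0#))))
    (≈ᴹ-trans (⊙-* 0# (λ _ → 0#) v) (*ₗ-zeroˡ _))

  x+[-1]x≈0 : ∀ x → x +ᴹ (- 1#) *ₗ x ≈ᴹ 0ᴹ
  x+[-1]x≈0 x = begin
    x +ᴹ (- 1#) *ₗ x         ≈⟨ +ᴹ-cong (*ₗ-identityˡ x) ≈ᴹ-refl ⟨
    1# *ₗ x +ᴹ (- 1#) *ₗ x   ≈⟨ *ₗ-distribʳ x 1# (- 1#) ⟨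
    (1# + - 1#) *ₗ x         ≈⟨ *ₗ-cong (F.-‿inverseʳ 1#) ≈ᴹ-refl ⟩
    0# *ₗ x                  ≈⟨ *ₗ-zeroˡ x ⟩
    0ᴹ                       ∎

  x+[-1]y≈0⇒x≈y : ∀ {x y} → x +ᴹ (- 1#) *ₗ y ≈ᴹ 0ᴹ → x ≈ᴹ y
  x+[-1]y≈0⇒x≈y {x} {y} eq = begin
    x                            ≈⟨ +ᴹ-identityʳ x ⟨
    x +ᴹ 0ᴹ                      ≈⟨ +ᴹ-cong ≈ᴹ-refl (≈ᴹ-trans (+ᴹ-comm _ _) (x+[-1]x≈0 y)) ⟨
    x +ᴹ ((- 1#) *ₗ y +ᴹ y)      ≈⟨ +ᴹ-assoc _ _ _ ⟨
    (x +ᴹ (- 1#) *ₗ y) +ᴹ y      ≈⟨ +ᴹ-cong eq ≈ᴹ-refl ⟩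
    0ᴹ +ᴹ y                      ≈⟨ +ᴹ-identityˡ y ⟩
    y                            ∎

  module _ {d} {v : Vector Carrierᴹ d} (independent : LinearlyIndependent X v) where

    ⊙-injective : ∀ {r r′} → r ⊙ v ≈ᴹ r′ ⊙ v → ∀ i → r i ≈ r′ i
    ⊙-injective {r} {r′} eq i = FL.x-y≈0⇒x≈y _ _
      (F.trans (F.+-congˡ (F.trans (F.-‿cong (F.sym (F.*-identityˡ _))) (FL.-‿distribˡ-* 1# (r′ i))))
      (independent (λ i → r i + - 1# * r′ i) (begin
        (λ i → r i + - 1# * r′ i) ⊙ v       ≈⟨ ⊙-+ r (λ i → - 1# * r′ i) v ⟩
        r ⊙ v +ᴹ (λ i → - 1# * r′ i) ⊙ v    ≈⟨ +ᴹ-cong eq (⊙-* (- 1#) r′ v) ⟩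
        r′ ⊙ v +ᴹ (- 1#) *ₗ (r′ ⊙ v)         ≈⟨ x+[-1]x≈0 _ ⟩
        0ᴹ                                  ∎) i))

    -- By counting: f induces an injection of F ^ d into F ^ h.
    independent⇒≤ : ∀ {h} (f : Vector Carrier d → Vector Carrier h) →
      (∀ r r′ → (∀ i → f r i ≈ f r′ i) → r ⊙ v ≈ᴹ r′ ⊙ v) → d ℕ.≤ h
    independent⇒≤ {h} f inj = ^-cancelˡ-≤ d h FF.2≤s
      (injection⇒≤ (vector-finite FF.finite d) (vector-finite FF.finite h) f
        (λ r r′ eq → ⊙-injective (inj r r′ eq)))

  module Coordinates {d} {v : Vector Carrierᴹ d} (basis : IsBasis X (whole X) v) where
    open IsBasis basis using (independent)

    coordinates : Carrierᴹ → Vector Carrier d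
    coordinates x = proj₁ (IsBasis.spanning basis {x} _)

    ⊙-coordinates : ∀ x → coordinates x ⊙ v ≈ᴹ x
    ⊙-coordinates x = ≈ᴹ-sym (proj₂ (IsBasis.spanning basis {x} _))

    coordinates-unique : ∀ {x} r → r ⊙ v ≈ᴹ x → ∀ i → coordinates x i ≈ r i
    coordinates-unique r eq = ⊙-injective independent (≈ᴹ-trans (⊙-coordinates _) (≈ᴹ-sym eq))

    coordinates-cong : ∀ {x y} → x ≈ᴹ y → ∀ i → coordinates x i ≈ coordinates y i
    coordinates-cong {x} {y} x≈y = coordinates-unique (coordinates y) (≈ᴹ-trans (⊙-coordinates y) (≈ᴹ-sym x≈y))

    coordinates-+ : ∀ x y i → coordinates (x +ᴹ y) i ≈ coordinates x i + coordinates y i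
    coordinates-+ x y = coordinates-unique _ (≈ᴹ-trans (⊙-+ (coordinates x) (coordinates y) v)
      (+ᴹ-cong (⊙-coordinates x) (⊙-coordinates y)))

    coordinates-* : ∀ b x i → coordinates (b *ₗ x) i ≈ b * coordinates x i
    coordinates-* b x = coordinates-unique _ (≈ᴹ-trans (⊙-* b (coordinates x) v) (*ₗ-cong F.refl (⊙-coordinates x)))

    coordinates-injective : ∀ {x y} → (∀ i → coordinates x i ≈ coordinates y i) → x ≈ᴹ y
    coordinates-injective eq = ≈ᴹ-trans (≈ᴹ-sym (⊙-coordinates _)) (≈ᴹ-trans (⊙-congˡ eq) (⊙-coordinates _))

    coordinates-0 : ∀ {x} → x ≈ᴹ 0ᴹ → ∀ i → coordinates x i ≈ 0#
    coordinates-0 x≈0 = coordinates-unique (λ _ → 0#) (≈ᴹ-trans (⊙-zero _ v (λ _ → F.refl)) (≈ᴹ-sym x≈0))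

    finite : Finite ≈ᴹ-setoid (q ℕ.^ d)
    finite = record
      { to        = λ i → V.to i ⊙ v
      ; from      = λ x → V.from (coordinates x)
      ; to-cong   = λ { ≡.refl → ≈ᴹ-refl }
      ; from-cong = λ eq → V.from-cong (coordinates-cong eq)
      ; inverse   =
          (λ { {x} ≡.refl → ≈ᴹ-trans (⊙-congˡ (V.to-from (coordinates x))) (⊙-coordinates x) })
        , (λ eq → ≡.trans (V.from-cong (coordinates-unique _ (≈ᴹ-sym eq))) (V.from-to _))
      }
      where module V = FiniteSetoid (vector-finite FF.finite d)

  unit : ∀ {d} → Fin d → Vector Carrier d
  unit zero    = 1# ∷ᵛ λ _ → 0#
  unit (suc i) = 0# ∷ᵛ unit i


  linear-⊙ : ∀ {d} (φ : Vector Carrier d → Carrierᴹ) →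
    (∀ {r r′} → (∀ i → r i ≈ r′ i) → φ r ≈ᴹ φ r′) →
    (∀ r r′ → φ (λ i → r i + r′ i) ≈ᴹ φ r +ᴹ φ r′) →
    (∀ b r → φ (λ i → b * r i) ≈ᴹ b *ₗ φ r) →
    ∀ r → r ⊙ (φ ∘ unit) ≈ᴹ φ r
  -- A vector without coordinates equals its own multiple by 0, so homogeneity forces `φ r` to
  -- vanish.
  linear-⊙ {zero} φ φ-cong φ-+ φ-* r = begin
    0ᴹ                     ≈⟨ *ₗ-zeroˡ (φ r) ⟨
    0# *ₗ φ r              ≈⟨ φ-* 0# r ⟨
    φ (λ i → 0# * r i)     ≈⟨ φ-cong (λ ()) ⟩
    φ r                    ∎
  linear-⊙ {suc d} φ φ-cong φ-+ φ-* r = begin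
    r zero *ₗ φ (unit zero) +ᴹ (r ∘ suc) ⊙ (φ ∘ (0# ∷ᵛ_) ∘ unit)
      ≈⟨ +ᴹ-cong (≈ᴹ-sym (φ-* (r zero) (unit zero)))
           (linear-⊙ (φ ∘ (0# ∷ᵛ_)) (λ eq → φ-cong (λ { zero → F.refl ; (suc i) → eq i }))
             (λ r r′ → ≈ᴹ-trans (φ-cong (λ { zero → F.sym (F.+-identityˡ 0#) ; (suc i) → F.refl })) (φ-+ (0# ∷ᵛ r) (0# ∷ᵛ r′)))
             (λ b r → ≈ᴹ-trans (φ-cong (λ { zero → F.sym (F.zeroʳ b) ; (suc i) → F.refl })) (φ-* b (0# ∷ᵛ r)))
             (r ∘ suc)) ⟩
    φ (λ i → r zero * unit zero i) +ᴹ φ (0# ∷ᵛ (r ∘ suc))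
      ≈⟨ φ-+ _ _ ⟨
    φ (λ i → r zero * unit zero i + (0# ∷ᵛ (r ∘ suc)) i)
      ≈⟨ φ-cong (λ { zero → F.trans (F.+-identityʳ _) (F.*-identityʳ _)
                   ; (suc i) → F.trans (F.+-congʳ (F.zeroʳ _)) (F.+-identityˡ _) }) ⟩
    φ r ∎

  -- The images of the unit vectors are a basis: the trivial kernel gives independence, surjectivity
  -- gives spanning. The dimensions of the spread elements and of `U` come from here.
  isomorphism⇒dim : ∀ {d} (S : Subspace X) (φ : Vector Carrier d → Carrierᴹ) →
    (∀ {r r′} → (∀ i → r i ≈ r′ i) → φ r ≈ᴹ φ r′) →
    (∀ r r′ → φ (λ i → r i + r′ i) ≈ᴹ φ r +ᴹ φ r′) →
    (∀ b r → φ (λ i → b * r i) ≈ᴹ b *ₗ φ r) →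
    (∀ r → φ r ∈ Subspace.member S) →
    (∀ r → φ r ≈ᴹ 0ᴹ → ∀ i → r i ≈ 0#) →
    (∀ {x} → x ∈ Subspace.member S → ∃ λ r → x ≈ᴹ φ r) →
    HasDim X S d
  isomorphism⇒dim S φ φ-cong φ-+ φ-* inside kernel onto = φ ∘ unit , record
    { inside      = λ i → inside (unit i)
    ; independent = λ r eq → kernel r (≈ᴹ-trans (≈ᴹ-sym (expand r)) eq)
    ; spanning    = λ x∈S → let (r , eq) = onto x∈S in r , ≈ᴹ-trans eq (≈ᴹ-sym (expand r))
    }
    where expand = linear-⊙ φ φ-cong φ-+ φ-*

  combination-closed : ∀ {d} (S : Subspace X) {v : Vector Carrierᴹ d} →
    (∀ i → v i ∈ Subspace.member S) → ∀ r → r ⊙ v ∈ Subspace.member S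
  combination-closed {zero}  S v∈S r = Subspace.0ᴹ-closed S
  combination-closed {suc d} S v∈S r = Subspace.+ᴹ-closed S (Subspace.*ₗ-closed S (r zero) (v∈S zero))
    (combination-closed S (v∈S ∘ suc) (r ∘ suc))

  HasDim-resp-≋ : ∀ {d} {S S′ : Subspace X} → _≋_ X S S′ → HasDim X S d → HasDim X S′ d
  HasDim-resp-≋ (S⊆S′ , S′⊆S) (v , basis) = v , record
    { inside      = λ i → S⊆S′ (IsBasis.inside basis i)
    ; independent = IsBasis.independent basis
    ; spanning    = IsBasis.spanning basis ∘ S′⊆S
    }

  module LeadingCoordinates {d} {v : Vector Carrierᴹ d} (basis : IsBasis X (whole X) v) where
    open Coordinates basis

    leading : ℕ → Subspace X
    leading D = record
      { member    = λ x → Lift (c ⊔ ℓ₁ ⊔ a ⊔ ℓ) (∀ i → D ℕ.≤ toℕ i → coordinates x i ≈ 0#)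
      ; resp-≈ᴹ   = λ x≈y (lift x∈) → lift λ i D≤i → F.trans (coordinates-cong (≈ᴹ-sym x≈y) i) (x∈ i D≤i)
      ; 0ᴹ-closed = lift λ i _ → coordinates-0 ≈ᴹ-refl i
      ; +ᴹ-closed = λ {x} {y} (lift x∈) (lift y∈) → lift λ i D≤i →
          F.trans (coordinates-+ x y i) (F.trans (F.+-cong (x∈ i D≤i) (y∈ i D≤i)) (F.+-identityˡ 0#))
      ; *ₗ-closed = λ b {x} (lift x∈) → lift λ i D≤i →
          F.trans (coordinates-* b x i) (F.trans (F.*-congˡ (x∈ i D≤i)) (F.zeroʳ b))
      }

    leading? : ∀ D → Decidable (Subspace.member (leading D))
    leading? D x = map′ lift lower
      (Finₚ.all? λ i → (D ℕₚ.≤? toℕ i) →-dec (coordinates x i FF.≟ 0#))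

    leading-dim : ∀ {D} → D ℕ.≤ d → HasDim X (leading D) D
    leading-dim {D} D≤d = isomorphism⇒dim (leading D) (λ r → pad r ⊙ v)
      (λ eq → ⊙-congˡ (pad-cong eq))
      (λ r r′ → ≈ᴹ-trans (⊙-congˡ (pad-+ r r′)) (⊙-+ (pad r) (pad r′) v))
      (λ b r → ≈ᴹ-trans (⊙-congˡ (pad-* b r)) (⊙-* b (pad r) v))
      (λ r → lift λ i D≤i → F.trans (coordinates-unique (pad r) ≈ᴹ-refl i) (pad-≥ r i D≤i))
      (λ r eq i → F.trans (F.sym (pad-inject r i)) (F.trans (F.sym (coordinates-unique (pad r) eq (inject≤ i D≤d))) (coordinates-0 ≈ᴹ-refl _)))
      (λ {x} (lift x∈) → (λ i → coordinates x (inject≤ i D≤d)) ,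
        ≈ᴹ-trans (≈ᴹ-sym (⊙-coordinates x)) (⊙-congˡ (λ i → F.sym (pad-coordinates x x∈ i))))
      where
      pad : Vector Carrier D → Vector Carrier d
      pad r i with toℕ i ℕₚ.<? D
      ... | yes i<D = r (fromℕ< i<D)
      ... | no  _   = 0#

      pad-cong : ∀ {r r′} → (∀ i → r i ≈ r′ i) → ∀ i → pad r i ≈ pad r′ i
      pad-cong eq i with toℕ i ℕₚ.<? D
      ... | yes i<D = eq _
      ... | no  _   = F.refl

      pad-+ : ∀ r r′ i → pad (λ i → r i + r′ i) i ≈ pad r i + pad r′ i
      pad-+ r r′ i with toℕ i ℕₚ.<? D
      ... | yes i<D = F.refl
      ... | no  _   = F.sym (F.+-identityˡ 0#)

      pad-* : ∀ b r i → pad (λ i → b * r i) i ≈ b * pad r i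
      pad-* b r i with toℕ i ℕₚ.<? D
      ... | yes i<D = F.refl
      ... | no  _   = F.sym (F.zeroʳ b)

      pad-≥ : ∀ r i → D ℕ.≤ toℕ i → pad r i ≈ 0#
      pad-≥ r i D≤i with toℕ i ℕₚ.<? D
      ... | yes i<D = contradiction i<D (ℕₚ.≤⇒≯ D≤i)
      ... | no  _   = F.refl

      pad-inject : ∀ r i → pad r (inject≤ i D≤d) ≈ r i
      pad-inject r i with toℕ (inject≤ i D≤d) ℕₚ.<? D
      ... | yes i<D = F.reflexive (≡.cong r (Finₚ.toℕ-injective (≡.trans (Finₚ.toℕ-fromℕ< i<D) (Finₚ.toℕ-inject≤ i D≤d))))
      ... | no  i≮D = contradiction (≡.subst (ℕ._< D) (≡.sym (Finₚ.toℕ-inject≤ i D≤d)) (Finₚ.toℕ<n i)) i≮D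

      pad-coordinates : ∀ x → (∀ i → D ℕ.≤ toℕ i → coordinates x i ≈ 0#) →
        ∀ i → pad (λ i → coordinates x (inject≤ i D≤d)) i ≈ coordinates x i
      pad-coordinates x x∈ i with toℕ i ℕₚ.<? D
      ... | yes i<D = F.reflexive (≡.cong (coordinates x) (Finₚ.toℕ-injective (≡.trans (Finₚ.toℕ-inject≤ _ D≤d) (Finₚ.toℕ-fromℕ< i<D))))
      ... | no  i≮D = F.sym (x∈ i (ℕₚ.≮⇒≥ i≮D))

  module _ {N} (enumeration : Fin N → Carrierᴹ) (exhaustive : ∀ x → ∃ λ i → enumeration i ≈ᴹ x)
           (_≟_ : ∀ x y → Dec (x ≈ᴹ y)) (S : Subspace X) where
    open Subspace S

    Spans : ∀ {d} → Vector Carrierᴹ d → Carrierᴹ → Set _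
    Spans v x = ∃ λ r → x ≈ᴹ r ⊙ v

    spans? : ∀ {d} (v : Vector Carrierᴹ d) → Decidable (Spans v)
    spans? {d} v x = V.∃? (λ eq p → ≈ᴹ-trans p (⊙-congˡ eq)) (λ r → x ≟ (r ⊙ v))
      where module V = FiniteSetoid (vector-finite FF.finite d)

    -- A vector is adopted when it lies in `S` but not in the span of those already chosen. The
    -- second condition is decidable because there are only finitely many coefficient vectors.
    greedy-basis : Decidable member → ∀ {n} (f : Fin n → Carrierᴹ) →
      ∃ λ d → ∃ λ (v : Vector Carrierᴹ d) → (∀ i → v i ∈ member) × LinearlyIndependent X v ×
        (∀ i → f i ∈ member → Spans v (f i))
    greedy-basis member? {zero} f = 0 , (λ ()) , (λ ()) , (λ _ _ ()) , (λ ())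
    greedy-basis member? {suc n} f
      with d , v , inside , independent , spans ← greedy-basis member? (f ∘ suc)
      with member? (f zero) | spans? v (f zero)
    ... | no f0∉S | _ = d , v , inside , independent ,
      λ { zero f0∈S → contradiction f0∈S f0∉S ; (suc i) → spans i }
    ... | yes _ | yes f0-spanned = d , v , inside , independent ,
      λ { zero _ → f0-spanned ; (suc i) → spans i }
    ... | yes f0∈S | no f0-new = suc d , f zero ∷ᵛ v ,
      (λ { zero → f0∈S ; (suc i) → inside i }) , independent′ ,
      λ { zero _ → (1# ∷ᵛ λ _ → 0#) , ≈ᴹ-sym (≈ᴹ-trans (+ᴹ-cong (*ₗ-identityˡ _) (⊙-zero _ v (λ _ → F.refl))) (+ᴹ-identityʳ _))
        ; (suc i) fi∈S → let (r , eq) = spans i fi∈S in (0# ∷ᵛ r) ,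
            ≈ᴹ-trans eq (≈ᴹ-sym (≈ᴹ-trans (+ᴹ-cong (*ₗ-zeroˡ _) ≈ᴹ-refl) (+ᴹ-identityˡ _))) }
      where
      independent′ : LinearlyIndependent X (f zero ∷ᵛ v)
      independent′ r eq with r zero FF.≟ 0#
      ... | yes r0≈0 = λ { zero → r0≈0 ; (suc i) → independent (r ∘ suc)
              (≈ᴹ-trans (≈ᴹ-sym (≈ᴹ-trans (+ᴹ-cong (≈ᴹ-trans (*ₗ-cong r0≈0 ≈ᴹ-refl) (*ₗ-zeroˡ _)) ≈ᴹ-refl) (+ᴹ-identityˡ _))) eq) i }
      -- A non-zero coefficient of `f zero` could be divided out, which would express `f zero`
      -- through `v` and contradict `f0-new`.
      ... | no r0≉0 with y , r0y≈1 ← FF.invert (r zero) r0≉0 = contradiction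
        ((λ i → - 1# * (y * r (suc i))) , x+[-1]y≈0⇒x≈y (begin
          f zero +ᴹ (- 1#) *ₗ (λ i → - 1# * (y * r (suc i))) ⊙ v
            ≈⟨ +ᴹ-cong ≈ᴹ-refl (⊙-* (- 1#) (λ i → - 1# * (y * r (suc i))) v) ⟨
          f zero +ᴹ (λ i → - 1# * (- 1# * (y * r (suc i)))) ⊙ v
            ≈⟨ +ᴹ-cong (≈ᴹ-trans (≈ᴹ-sym (*ₗ-identityˡ _)) (*ₗ-cong (F.sym (F.trans (F.*-comm _ _) r0y≈1)) ≈ᴹ-refl))
                       (⊙-congˡ (λ i → neg-neg (y * r (suc i)))) ⟩
          (y * r zero) *ₗ f zero +ᴹ (λ i → y * r (suc i)) ⊙ v
            ≈⟨ ⊙-* y r (f zero ∷ᵛ v) ⟩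
          y *ₗ (r ⊙ (f zero ∷ᵛ v))
            ≈⟨ *ₗ-cong F.refl eq ⟩
          y *ₗ 0ᴹ
            ≈⟨ *ₗ-zeroʳ y ⟩
          0ᴹ ∎)) f0-new
        where
        neg-neg : ∀ x → - 1# * (- 1# * x) ≈ x
        neg-neg x = F.trans (F.sym (F.*-assoc _ _ _)) (F.trans (F.*-congʳ (F.trans (-1*x≈-x (- 1#)) (⁻¹-involutive 1#))) (F.*-identityˡ x))
          where
          open import Algebra.Properties.Ring F.ring using (-1*x≈-x)
          open import Algebra.Properties.Group F.+-group using (⁻¹-involutive)

    -- Supplies the dimensions that are not known in advance: that of the quotient ring over the
    -- base field and those of the intersections with `U`. The enumeration may repeat elements, as
    -- it does for the quotient ring, whose elements are listed by representatives.
    decidable⇒dim : Decidable member → ∃ λ d → HasDim X S d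
    decidable⇒dim member? with d , v , inside , independent , spans ← greedy-basis member? enumeration =
      d , v , record
        { inside      = inside
        ; independent = independent
        ; spanning    = λ {x} x∈S →
            let (i , i≈x) = exhaustive x
                (r , eq)  = spans i (resp-≈ᴹ (≈ᴹ-sym i≈x) x∈S)
            in r , ≈ᴹ-trans (≈ᴹ-sym i≈x) eq
        }

-- Extensions by linear recurring sequences

record RingHom {c ℓ c′ ℓ′} (R : CommutativeRing c ℓ) (K : CommutativeRing c′ ℓ′) : Set (c ⊔ ℓ ⊔ c′ ⊔ ℓ′) where
  private
    module R = CommutativeRing R
    module K = CommutativeRing K
  field
    ⟦_⟧    : R.Carrier → K.Carrier
    ⟦⟧-cong : ∀ {x y} → x R.≈ y → ⟦ x ⟧ K.≈ ⟦ y ⟧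
    ⟦⟧-+    : ∀ x y → ⟦ x R.+ y ⟧ K.≈ ⟦ x ⟧ K.+ ⟦ y ⟧
    ⟦⟧-*    : ∀ x y → ⟦ x R.* y ⟧ K.≈ ⟦ x ⟧ K.* ⟦ y ⟧
    ⟦⟧-1    : ⟦ R.1# ⟧ K.≈ K.1#

  private
    module RL = RingLemmas R
    module KL = RingLemmas K

  ⟦⟧-0 : ⟦ R.0# ⟧ K.≈ K.0#
  ⟦⟧-0 = K.trans (K.sym (KL.x+y-x≈y ⟦ R.0# ⟧ ⟦ R.0# ⟧))
    (K.trans (K.+-congʳ (K.trans (K.sym (⟦⟧-+ R.0# R.0#)) (⟦⟧-cong (R.+-identityˡ R.0#)))) (K.-‿inverseʳ _))

  ⟦⟧-^ : ∀ x n → ⟦ x RL.^ n ⟧ K.≈ ⟦ x ⟧ KL.^ n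
  ⟦⟧-^ x zero    = ⟦⟧-1
  ⟦⟧-^ x (suc n) = K.trans (⟦⟧-* _ _) (K.*-congˡ (⟦⟧-^ x n))

  ⟦⟧-· : ∀ n → ⟦ n RL.· R.1# ⟧ K.≈ n KL.· K.1#
  ⟦⟧-· zero    = ⟦⟧-0
  ⟦⟧-· (suc n) = K.trans (⟦⟧-+ _ _) (K.+-cong ⟦⟧-1 (⟦⟧-· n))

  characteristic : ∀ {n} → n RL.· R.1# R.≈ R.0# → n KL.· K.1# K.≈ K.0#
  characteristic {n} eq = K.trans (K.sym (⟦⟧-· n)) (K.trans (⟦⟧-cong eq) ⟦⟧-0)

  restrictScalars : Module R c′ ℓ′
  restrictScalars = record
    { Carrierᴹ = K.Carrier
    ; _≈ᴹ_     = K._≈_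
    ; _+ᴹ_     = K._+_
    ; _*ₗ_     = λ a x → ⟦ a ⟧ K.* x
    ; _*ᵣ_     = λ x a → ⟦ a ⟧ K.* x
    ; 0ᴹ       = K.0#
    ; -ᴹ_      = K.-_
    ; isModule = IsModuleFromLeft.isModule {commutativeRing = R} (record
      { isLeftModule = record
        { isLeftSemimodule = record
          { +ᴹ-isCommutativeMonoid = K.+-isCommutativeMonoid
          ; isPreleftSemimodule = record
            { *ₗ-cong      = λ a≈b x≈y → K.*-cong (⟦⟧-cong a≈b) x≈y
            ; *ₗ-zeroˡ     = λ x → K.trans (K.*-congʳ ⟦⟧-0) (K.zeroˡ x)
            ; *ₗ-distribʳ  = λ x a b → K.trans (K.*-congʳ (⟦⟧-+ a b)) (K.distribʳ x _ _)
            ; *ₗ-identityˡ = λ x → K.trans (K.*-congʳ ⟦⟧-1) (K.*-identityˡ x)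
            ; *ₗ-assoc     = λ a b x → K.trans (K.*-congʳ (⟦⟧-* a b)) (K.*-assoc _ _ x)
            ; *ₗ-zeroʳ     = λ a → K.zeroʳ _
            ; *ₗ-distribˡ  = λ a x y → K.distribˡ _ x y
            }
          }
        ; -ᴹ‿cong    = K.-‿cong
        ; -ᴹ‿inverse = K.-‿inverse
        }
      })
    }

-- Polynomials acting on sequences, and the quotient by an annihilator

module Sequences {c ℓ} (R : CommutativeRing c ℓ) where
  open CommutativeRing R hiding (zero)
  open RingLemmas R
  open SetoidReasoning setoid

  Sequence : Set c
  Sequence = ℕ → Carrier

  infix 4 _≐_
  _≐_ : Sequence → Sequence → Set ℓ
  s ≐ t = ∀ n → s n ≈ t n

  Poly : Set c
  Poly = List Carrier

  -- Σᵢ aᵢ Tⁱ acts on sequences, T being the shift.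
  act : Poly → Sequence → Sequence
  act []      s n = 0#
  act (a ∷ f) s n = a * s n + act f s (suc n)

  infixl 6 _⊕_
  infixl 7 _⊗_
  _⊕_ _⊗_ : Poly → Poly → Poly
  []      ⊕ g       = g
  (a ∷ f) ⊕ []      = a ∷ f
  (a ∷ f) ⊕ (b ∷ g) = (a + b) ∷ (f ⊕ g)

  scale : Carrier → Poly → Poly
  scale a = List.map (a *_)

  [] ⊗ g      = []
  (a ∷ f) ⊗ g = scale a g ⊕ (0# ∷ f ⊗ g)

  infix 8 ⊖_
  ⊖_ : Poly → Poly
  ⊖ f = scale (- 1#) f

  const : Carrier → Poly
  const a = a ∷ []

  T : Poly
  T = 0# ∷ 1# ∷ []

  act-cong : ∀ f {s t} → s ≐ t → act f s ≐ act f t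
  act-cong []      s≐t n = refl
  act-cong (a ∷ f) s≐t n = +-cong (*-congˡ (s≐t n)) (act-cong f s≐t (suc n))

  act-⊕ : ∀ f g s n → act (f ⊕ g) s n ≈ act f s n + act g s n
  act-⊕ []      g       s n = sym (+-identityˡ _)
  act-⊕ (a ∷ f) []      s n = sym (+-identityʳ _)
  act-⊕ (a ∷ f) (b ∷ g) s n = trans (+-congˡ (act-⊕ f g s (suc n)))
    (solve 5 (λ a b s f g → (a :+ b) :* s :+ (f :+ g) := (a :* s :+ f) :+ (b :* s :+ g)) refl
      a b (s n) (act f s (suc n)) (act g s (suc n)))

  act-scale : ∀ b f s n → act (scale b f) s n ≈ b * act f s n
  act-scale b []      s n = sym (zeroʳ b)
  act-scale b (a ∷ f) s n = trans (+-cong (*-assoc _ _ _) (act-scale b f s (suc n))) (sym (distribˡ _ _ _))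

  act-⊗ : ∀ f g s n → act (f ⊗ g) s n ≈ act f (act g s) n
  act-⊗ []      g s n = refl
  act-⊗ (a ∷ f) g s n = trans (act-⊕ (scale a g) (0# ∷ f ⊗ g) s n)
    (+-cong (act-scale a g s n) (trans (+-congʳ (zeroˡ _)) (trans (+-identityˡ _) (act-⊗ f g s (suc n)))))

  act-⊖ : ∀ f s n → act (⊖ f) s n ≈ - act f s n
  act-⊖ f s n = trans (act-scale (- 1#) f s n) (trans (sym (-‿distribˡ-* _ _)) (-‿cong (*-identityˡ _)))

  act-const : ∀ a s n → act (const a) s n ≈ a * s n
  act-const a s n = +-identityʳ _

  act-T : ∀ s n → act T s n ≈ s (suc n)
  act-T s n = trans (+-cong (zeroˡ _) (trans (+-identityʳ _) (*-identityˡ _))) (+-identityˡ _)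

  act-shift : ∀ f s n → act f (s ∘ suc) n ≈ act f s (suc n)
  act-shift []      s n = refl
  act-shift (a ∷ f) s n = +-congˡ (act-shift f s (suc n))

  act-sum : ∀ f s t n → act f (λ n → s n + t n) n ≈ act f s n + act f t n
  act-sum []      s t n = sym (+-identityˡ _)
  act-sum (a ∷ f) s t n = trans (+-congˡ (act-sum f s t (suc n)))
    (solve 5 (λ a x y f g → a :* (x :+ y) :+ (f :+ g) := (a :* x :+ f) :+ (a :* y :+ g)) refl
      a (s n) (t n) (act f s (suc n)) (act f t (suc n)))

  act-multiple : ∀ f b s n → act f (λ n → b * s n) n ≈ b * act f s n
  act-multiple []      b s n = sym (zeroʳ b)
  act-multiple (a ∷ f) b s n = trans (+-congˡ (act-multiple f b s (suc n)))
    (solve 4 (λ a b s f → a :* (b :* s) :+ b :* f := b :* (a :* s :+ f)) refl a b (s n) (act f s (suc n)))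

  -- The action of `g` is linear and commutes with the shift. Commutativity of the quotient ring is
  -- read off from this, without comparing the coefficients of products.
  act-comm : ∀ f g s n → act f (act g s) n ≈ act g (act f s) n
  act-comm [] g s n = sym (trans (act-cong g (λ _ → sym (zeroˡ 0#)) n) (trans (act-multiple g 0# (λ _ → 0#) n) (zeroˡ _)))
  act-comm (a ∷ f) g s n = begin
    a * act g s n + act f (act g s) (suc n)
      ≈⟨ +-cong (act-multiple g a s n) (trans (act-shift g (act f s) n) (act-comm g f s (suc n))) ⟨
    act g (λ n → a * s n) n + act g (act f s ∘ suc) n
      ≈⟨ act-sum g (λ n → a * s n) (act f s ∘ suc) n ⟨
    act g (act (a ∷ f) s) n ∎

  -- The ring F[T] / Ann(δ).
  module Quotient (δ : Sequence) where
    infix 4 _∼_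
    _∼_ : Poly → Poly → Set ℓ
    f ∼ g = act f δ ≐ act g δ

    private
      ⊕-cong : ∀ {f f′ g g′} → f ∼ f′ → g ∼ g′ → f ⊕ g ∼ f′ ⊕ g′
      ⊕-cong {f} {f′} {g} {g′} p q n = trans (act-⊕ f g δ n) (trans (+-cong (p n) (q n)) (sym (act-⊕ f′ g′ δ n)))

      ⊗-comm : ∀ f g → f ⊗ g ∼ g ⊗ f
      ⊗-comm f g n = trans (act-⊗ f g δ n) (trans (act-comm f g δ n) (sym (act-⊗ g f δ n)))

      ⊗-congˡ : ∀ f {g g′} → g ∼ g′ → f ⊗ g ∼ f ⊗ g′
      ⊗-congˡ f {g} {g′} p n = trans (act-⊗ f g δ n) (trans (act-cong f p n) (sym (act-⊗ f g′ δ n)))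

      ⊗-cong : ∀ {f f′ g g′} → f ∼ f′ → g ∼ g′ → f ⊗ g ∼ f′ ⊗ g′
      ⊗-cong {f} {f′} {g} {g′} p q n = trans (⊗-congˡ f q n) (trans (⊗-comm f g′ n) (trans (⊗-congˡ g′ p n) (⊗-comm g′ f′ n)))

      ⊕-assoc : ∀ f g h → (f ⊕ g) ⊕ h ∼ f ⊕ (g ⊕ h)
      ⊕-assoc f g h n = begin
        act ((f ⊕ g) ⊕ h) δ n                ≈⟨ trans (act-⊕ (f ⊕ g) h δ n) (+-congʳ (act-⊕ f g δ n)) ⟩
        (act f δ n + act g δ n) + act h δ n  ≈⟨ +-assoc _ _ _ ⟩
        act f δ n + (act g δ n + act h δ n)  ≈⟨ trans (act-⊕ f (g ⊕ h) δ n) (+-congˡ (act-⊕ g h δ n)) ⟨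
        act (f ⊕ (g ⊕ h)) δ n                ∎

      ⊕-comm : ∀ f g → f ⊕ g ∼ g ⊕ f
      ⊕-comm f g n = trans (act-⊕ f g δ n) (trans (+-comm _ _) (sym (act-⊕ g f δ n)))

      ⊕-identityʳ : ∀ f → f ⊕ [] ∼ f
      ⊕-identityʳ f n = trans (act-⊕ f [] δ n) (+-identityʳ _)

      ⊖-inverseʳ : ∀ f → f ⊕ ⊖ f ∼ []
      ⊖-inverseʳ f n = trans (act-⊕ f (⊖ f) δ n) (trans (+-congˡ (act-⊖ f δ n)) (-‿inverseʳ _))

      ⊖-cong : ∀ {f g} → f ∼ g → ⊖ f ∼ ⊖ g
      ⊖-cong {f} {g} p n = trans (act-⊖ f δ n) (trans (-‿cong (p n)) (sym (act-⊖ g δ n)))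

      ⊗-assoc : ∀ f g h → (f ⊗ g) ⊗ h ∼ f ⊗ (g ⊗ h)
      ⊗-assoc f g h n = begin
        act ((f ⊗ g) ⊗ h) δ n       ≈⟨ trans (act-⊗ (f ⊗ g) h δ n) (act-⊗ f g (act h δ) n) ⟩
        act f (act g (act h δ)) n   ≈⟨ trans (act-⊗ f (g ⊗ h) δ n) (act-cong f (act-⊗ g h δ) n) ⟨
        act (f ⊗ (g ⊗ h)) δ n       ∎

      ⊗-identityˡ : ∀ f → const 1# ⊗ f ∼ f
      ⊗-identityˡ f n = trans (act-⊗ (const 1#) f δ n) (trans (act-const 1# (act f δ) n) (*-identityˡ _))

      ⊗-distribʳ : ∀ h f g → (f ⊕ g) ⊗ h ∼ (f ⊗ h) ⊕ (g ⊗ h)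
      ⊗-distribʳ h f g n = begin
        act ((f ⊕ g) ⊗ h) δ n                  ≈⟨ trans (act-⊗ (f ⊕ g) h δ n) (act-⊕ f g (act h δ) n) ⟩
        act f (act h δ) n + act g (act h δ) n  ≈⟨ trans (act-⊕ (f ⊗ h) (g ⊗ h) δ n) (+-cong (act-⊗ f h δ n) (act-⊗ g h δ n)) ⟨
        act ((f ⊗ h) ⊕ (g ⊗ h)) δ n            ∎

    commutativeRing : CommutativeRing c ℓ
    commutativeRing = record
      { Carrier = Poly ; _≈_ = _∼_ ; _+_ = _⊕_ ; _*_ = _⊗_ ; -_ = ⊖_ ; 0# = [] ; 1# = const 1#
      ; isCommutativeRing = record
        { isRing = record
          { +-isAbelianGroup = record
            { isGroup = record
              { isMonoid = record
                { isSemigroup = record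
                  { isMagma = record
                    { isEquivalence = record
                      { refl = λ n → refl ; sym = λ p n → sym (p n) ; trans = λ p q n → trans (p n) (q n) }
                    ; ∙-cong = λ {f} {f′} {g} {g′} → ⊕-cong {f} {f′} {g} {g′}
                    }
                  ; assoc = ⊕-assoc
                  }
                ; identity = (λ f n → refl) , ⊕-identityʳ
                }
              ; inverse = (λ f n → trans (⊕-comm (⊖ f) f n) (⊖-inverseʳ f n)) , ⊖-inverseʳ
              ; ⁻¹-cong = λ {f} {g} → ⊖-cong {f} {g}
              }
            ; comm = ⊕-comm
            }
          ; *-cong = λ {f} {f′} {g} {g′} → ⊗-cong {f} {f′} {g} {g′}
          ; *-assoc = ⊗-assoc
          ; *-identity = ⊗-identityˡ , (λ f n → trans (⊗-comm f (const 1#) n) (⊗-identityˡ f n))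
          ; distrib = (λ h f g n → trans (⊗-comm h (f ⊕ g) n) (trans (⊗-distribʳ h f g n)
                        (⊕-cong {f ⊗ h} {h ⊗ f} {g ⊗ h} {h ⊗ g} (⊗-comm f h) (⊗-comm g h) n))) , ⊗-distribʳ
          }
        ; *-comm = ⊗-comm
        }
      }

    constants : RingHom R commutativeRing
    constants = record
      { ⟦_⟧    = const
      ; ⟦⟧-cong = λ a≈b n → +-congʳ (*-congʳ a≈b)
      ; ⟦⟧-+    = λ a b n → trans (act-const (a + b) δ n) (trans (distribʳ _ _ _) (sym
          (trans (act-⊕ (const a) (const b) δ n) (+-cong (act-const a δ n) (act-const b δ n)))))
      ; ⟦⟧-*    = λ a b n → trans (act-const (a * b) δ n) (trans (*-assoc _ _ _) (sym
          (trans (act-⊗ (const a) (const b) δ n) (trans (act-const a (act (const b) δ) n) (*-congˡ (act-const b δ n))))))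
      ; ⟦⟧-1    = λ n → refl
      }

    horner : ∀ a f → a ∷ f ∼ const a ⊕ T ⊗ f
    horner a f n = sym (trans (act-⊕ (const a) (T ⊗ f) δ n)
      (+-cong (act-const a δ n) (trans (act-⊗ T f δ n) (act-T (act f δ) n))))

record Extension {c ℓ} (R : CommutativeRing c ℓ) (q m : ℕ) : Set (Level.suc (c ⊔ ℓ)) where
  field
    K             : CommutativeRing c ℓ
    hom           : RingHom R K
    isFiniteField : IsFiniteField K (q ℕ.^ m)
    hasDim        : HasDim (RingHom.restrictScalars hom) (whole (RingHom.restrictScalars hom)) m

-- Construction of the field with q ^ m elements

module Construction {c ℓ} {R : CommutativeRing c ℓ} {q} (isFiniteField : IsFiniteField R q)
  {p k} (pp : Prime p) (q≡p^k : q ≡ p ℕ.^ k) (j N′ : ℕ) (q^m≡N+1 : q ℕ.^ suc j ≡ suc (suc N′)) where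

  open CommutativeRing R hiding (zero)
  open RingLemmas R
  open Sequences R
  private module FF = FiniteField isFiniteField
  open SetoidReasoning setoid

  -- `N` is `q ^ m - 1`. The parameters are the predecessors `j = m - 1` and `N′ = N - 1`, so that
  -- `N` is visibly positive, as reduction modulo `N` requires.
  m N : ℕ
  m = suc j
  N = suc N′

  Periodic : Sequence → Set ℓ
  Periodic s = ∀ n → s (N ℕ.+ n) ≈ s n

  act-periodic : ∀ f {s} → Periodic s → Periodic (act f s)
  act-periodic []      per n = refl
  act-periodic (a ∷ f) {s} per n = +-cong (*-congˡ (per n))
    (trans (reflexive (≡.cong (act f s) (≡.sym (ℕₚ.+-suc N n)))) (act-periodic f per (suc n)))

  periodic-% : ∀ {s} → Periodic s → ∀ n → s n ≈ s (n % N)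
  periodic-% {s} per n = trans (reflexive (≡.cong s (m≡m%n+[m/n]*n n N))) (go (n / N))
    where
    go : ∀ d → s (n % N ℕ.+ d ℕ.* N) ≈ s (n % N)
    go zero    = reflexive (≡.cong s (ℕₚ.+-identityʳ _))
    go (suc d) = trans (reflexive (≡.cong s (≡.trans (≡.sym (ℕₚ.+-assoc (n % N) N (d ℕ.* N)))
      (≡.trans (≡.cong (ℕ._+ d ℕ.* N) (ℕₚ.+-comm (n % N) N)) (ℕₚ.+-assoc N (n % N) (d ℕ.* N)))))) (trans (per _) (go d))

  periodic-≐? : ∀ {s t} → Periodic s → Periodic t → Dec (s ≐ t)
  periodic-≐? {s} {t} per per′ = map′
    (λ eq n → trans (periodic-% per n) (trans
      (≡.subst (λ i → s i ≈ t i) (Finₚ.toℕ-fromℕ< (m%n<n n N)) (eq (fromℕ< (m%n<n n N))))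
      (sym (periodic-% per′ n))))
    (λ eq i → eq (toℕ i))
    (Finₚ.all? {N} (λ i → s (toℕ i) FF.≟ t (toℕ i)))

  0ˢ : Sequence
  0ˢ _ = 0#

  -- The `_^_` of the quotient ring belongs to a ring that depends on `δ`. This copy does not
  -- mention `δ` and so keeps its meaning while `δ` is being replaced.
  power : Poly → ℕ → Poly
  power f zero    = const 1#
  power f (suc n) = f ⊗ power f n

  power≡^ : ∀ δ f n → power f n ≡ RingLemmas._^_ (Quotient.commutativeRing δ) f n
  power≡^ δ f zero    = ≡.refl
  power≡^ δ f (suc n) = ≡.cong (f ⊗_) (power≡^ δ f n)

  act-power-T : ∀ n s i → act (power T n) s i ≈ s (n ℕ.+ i)
  act-power-T zero    s i = trans (act-const 1# s i) (*-identityˡ _)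
  act-power-T (suc n) s i = trans (act-⊗ T (power T n) s i) (trans (act-T (act (power T n) s) i)
    (trans (act-power-T n s (suc i)) (reflexive (≡.cong s (ℕₚ.+-suc n i)))))

  fermat^m : ∀ m a → a ^ (q ℕ.^ m) ≈ a
  fermat^m zero    a = *-identityʳ a
  fermat^m (suc m) a = trans (sym (^-assocʳ a q (q ℕ.^ m))) (trans (^-congˡ (q ℕ.^ m) (FF.fermat a)) (fermat^m m a))

  q^m≡p^km : ∀ m → q ℕ.^ m ≡ p ℕ.^ (k ℕ.* m)
  q^m≡p^km m = ≡.trans (≡.cong (ℕ._^ m) q≡p^k) (ℕₚ.^-*-assoc p k m)

  -- x ↦ x ^ (q ^ m) is additive and fixes the generators: F, and T because of the period.
  module _ {δ} (per : Periodic δ) where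
    private
      module K  = CommutativeRing (Quotient.commutativeRing δ)
      module KL = RingLemmas (Quotient.commutativeRing δ)
      module H  = RingHom (Quotient.constants δ)

    pow-fixed : ∀ f → f KL.^ (q ℕ.^ m) K.≈ f
    pow-fixed [] = ≡.subst (λ n → [] KL.^ n K.≈ []) (≡.sym q^m≡N+1) (KL.0^n≈0 (suc N))
    pow-fixed (a ∷ f) = begin′
      (a ∷ f) KL.^ Q                       ≈′⟨ KL.^-congˡ Q (Quotient.horner δ a f) ⟩
      (const a ⊕ T ⊗ f) KL.^ Q             ≈′⟨ additive (const a) (T ⊗ f) ⟩
      const a KL.^ Q ⊕ (T ⊗ f) KL.^ Q      ≈′⟨ K.+-cong {const a KL.^ Q} {const a} {(T ⊗ f) KL.^ Q} {T ⊗ f} const-fixed T-fixed ⟩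
      const a ⊕ T ⊗ f                      ≈′⟨ K.sym {a ∷ f} {const a ⊕ T ⊗ f} (Quotient.horner δ a f) ⟩
      a ∷ f                                ∎′
      where
      Q = q ℕ.^ m
      open SetoidReasoning K.setoid renaming (begin_ to begin′_; _∎ to _∎′; step-≈-⟩ to step′)
      infixr 2 step″
      step″ = step′
      syntax step″ x y≈z x≈y = x ≈′⟨ x≈y ⟩ y≈z
      additive : ∀ x y → (x ⊕ y) KL.^ Q K.≈ x KL.^ Q ⊕ y KL.^ Q
      additive x y = ≡.subst (λ n → (x ⊕ y) KL.^ n K.≈ x KL.^ n ⊕ y KL.^ n) (≡.sym (q^m≡p^km m))
        (KL.Characteristic.^p^k-distrib-+ pp (H.characteristic {p} (FF.^-p·1 p k q≡p^k)) (k ℕ.* m) x y)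
      const-fixed : const a KL.^ Q K.≈ const a
      const-fixed = K.trans {const a KL.^ Q} {const (a ^ Q)} {const a}
        (K.sym {const (a ^ Q)} {const a KL.^ Q} (H.⟦⟧-^ a Q)) (H.⟦⟧-cong (fermat^m m a))
      T^Q : T KL.^ Q K.≈ T
      T^Q n = trans (reflexive (≡.cong (λ f → act f δ n) (≡.sym (power≡^ δ T Q)))) (trans (act-power-T Q δ n)
        (trans (reflexive (≡.cong δ (≡.trans (≡.cong (ℕ._+ n) q^m≡N+1) (≡.sym (ℕₚ.+-suc N n))))) (trans (per (suc n)) (sym (act-T δ n)))))
      T-fixed : (T ⊗ f) KL.^ Q K.≈ T ⊗ f
      T-fixed = K.trans {(T ⊗ f) KL.^ Q} {T KL.^ Q ⊗ f KL.^ Q} {T ⊗ f} (KL.^-distrib-* T f Q)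
        (K.*-cong {T KL.^ Q} {T} {f KL.^ Q} {f} T^Q (pow-fixed f))

    act-power-fixed : ∀ f → act (power f (suc N)) δ ≐ act f δ
    act-power-fixed f n = trans (reflexive (≡.cong (λ g → act g δ n)
      (≡.trans (power≡^ δ f (suc N)) (≡.cong (f KL.^_) (≡.sym q^m≡N+1))))) (pow-fixed f n)

  -- Read in `F[T] / Ann δ`: `z` is a unit with inverse `z ^ N′`, respectively `z` is 0.
  Regular Zero : Poly → Sequence → Set ℓ
  Regular z δ = act (power z N) δ ≐ δ
  Zero    z δ = act z δ ≐ 0ˢ

  -- Polynomial actions commute, so `Ann δ` is contained in `Ann (act w δ)` and every relation of
  -- the old quotient ring persists in the new one.
  regular-act : ∀ w {z δ} → Regular z δ → Regular z (act w δ)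
  regular-act w {z} {δ} reg n = trans (act-comm (power z N) w δ n) (act-cong w reg n)

  act-0ˢ : ∀ w → act w 0ˢ ≐ 0ˢ
  act-0ˢ w n = trans (act-cong w (λ _ → sym (zeroˡ 0#)) n) (trans (act-multiple w 0# 0ˢ n) (zeroˡ _))

  zero-act : ∀ w {z δ} → Zero z δ → Zero z (act w δ)
  zero-act w {z} {δ} z≐0 n = trans (act-comm z w δ n) (trans (act-cong w z≐0 n) (act-0ˢ w n))

  -- Applying `z ^ N` to `z δ` gives `z ^ (N + 1) δ`, and `N + 1 = q ^ m` is an exponent that fixes
  -- every element of the quotient ring.
  becomes-regular : ∀ z {δ} → Periodic δ → Regular z (act z δ)
  becomes-regular z {δ} per n = trans (act-comm (power z N) z δ n)
    (trans (sym (act-⊗ z (power z N) δ n)) (act-power-fixed per z n))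

  -- `δ` is replaced by `z δ` only if this is non-zero. What was settled for earlier polynomials
  -- persists as the annihilator grows; the clause about arbitrary `z` carries over the units
  -- created before the refinement, namely the `frob d`.
  refine : ∀ {n} (zs : Fin n → Poly) {δ} → Periodic δ → ¬ (δ ≐ 0ˢ) →
    ∃ λ δ′ → Periodic δ′ × ¬ (δ′ ≐ 0ˢ) × (∀ z → Regular z δ → Regular z δ′) ×
      (∀ i → Zero (zs i) δ′ ⊎ Regular (zs i) δ′)
  refine {zero} zs {δ} per δ≢0 = δ , per , δ≢0 , (λ _ → id) , λ ()
  refine {suc n} zs per δ≢0
    with δ₁ , per₁ , δ₁≢0 , keep , split ← refine (zs ∘ suc) per δ≢0
    with periodic-≐? {t = 0ˢ} (act-periodic (zs zero) per₁) (λ _ → refl)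
  ... | yes z≐0 = δ₁ , per₁ , δ₁≢0 , keep , λ { zero → inj₁ z≐0 ; (suc i) → split i }
  ... | no  z≢0 = act (zs zero) δ₁ , act-periodic (zs zero) per₁ , z≢0 ,
    (λ z → regular-act (zs zero) {z} ∘ keep z) ,
    λ { zero    → inj₂ (becomes-regular (zs zero) per₁)
      ; (suc i) → [ (λ z≐0 → inj₁ (zero-act (zs zero) {zs (suc i)} z≐0))
                  , (λ reg → inj₂ (regular-act (zs zero) {zs (suc i)} reg)) ]′ (split i) }

  frob : ℕ → Poly
  frob d = power T (q ℕ.^ d) ⊕ ⊖ T

  act-frob : ∀ d s i → act (frob d) s i ≈ s (q ℕ.^ d ℕ.+ i) - s (suc i)
  act-frob d s i = trans (act-⊕ (power T (q ℕ.^ d)) (⊖ T) s i)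
    (+-cong (act-power-T (q ℕ.^ d) s i) (trans (act-⊖ T s i) (-‿cong (act-T s i))))

  frobs : ℕ → Sequence → Sequence
  frobs zero    s = s
  frobs (suc n) s = frobs n (act (frob (suc n)) s)

  -- The degree of the product of the T^(q^d) - T for 1 ≤ d ≤ n.
  degree : ℕ → ℕ
  degree zero    = 0
  degree (suc n) = q ℕ.^ suc n ℕ.+ degree n

  frobs-periodic : ∀ n {s} → Periodic s → Periodic (frobs n s)
  frobs-periodic zero    per = per
  frobs-periodic (suc n) per = frobs-periodic n (act-periodic (frob (suc n)) per)

  frobs-regular : ∀ n {s z} → Regular z s → Regular z (frobs n s)
  frobs-regular zero    reg = reg
  frobs-regular (suc n) {z = z} reg = frobs-regular n {z = z} (regular-act (frob (suc n)) {z} reg)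

  -- Each factor becomes a unit at the moment it is applied, and the factors applied after it
  -- preserve this.
  frob-regular : ∀ n {s} → Periodic s → ∀ d → d ℕ.< n → Regular (frob (suc d)) (frobs n s)
  frob-regular (suc n) per d d<n with d ℕₚ.≟ n
  ... | yes ≡.refl = frobs-regular n {z = frob (suc n)} (becomes-regular (frob (suc n)) per)
  ... | no  d≢n    = frob-regular n (act-periodic (frob (suc n)) per) d (ℕₚ.≤∧≢⇒< (ℕ.s≤s⁻¹ d<n) d≢n)

  -- The product of the `frob d` is monic of degree `degree n`, and its lower coefficients meet only
  -- vanishing entries of `s`.
  frobs-leading : ∀ n {s} → (∀ i → i ℕ.< degree n → s i ≈ 0#) → frobs n s 0 ≈ s (degree n)
  frobs-leading zero    s≈0 = refl
  frobs-leading (suc n) {s} s≈0 = trans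
    (frobs-leading n (λ i i<D → trans (act-frob (suc n) s i) (trans
      (+-cong (s≈0 _ (ℕₚ.+-monoʳ-< (q ℕ.^ suc n) i<D)) (-‿cong (s≈0 _ (ℕₚ.≤-<-trans i<D
        (ℕₚ.m<n+m (degree n) (ℕₚ.≤-trans (ℕ.s≤s ℕ.z≤n) (FF.2≤s^ n)))))))
      (-‿inverseʳ 0#))))
    (trans (act-frob (suc n) s (degree n))
      (trans (+-congˡ (-‿cong (s≈0 _ (ℕₚ.+-monoˡ-≤ (degree n) (FF.2≤s^ n))))) (x-0≈x _)))

  -- The 2 is the slack that yields `degree j < N`, with `N` one less than `q ^ suc j`. Adding
  -- `q ^ suc n` to both sides bounds the next sum by `2 q ^ suc n`, and `2 ≤ q`.
  degree+2≤ : ∀ n → 2 ℕ.+ degree n ℕ.≤ q ℕ.^ suc n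
  degree+2≤ zero    = FF.2≤s^ 0
  degree+2≤ (suc n) = ℕₚ.≤-trans (ℕₚ.≤-reflexive
      (≡.trans (≡.cong (ℕ._+ degree n) (ℕₚ.+-comm 2 x)) (ℕₚ.+-assoc x 2 (degree n))))
    (ℕₚ.≤-trans (ℕₚ.+-monoʳ-≤ x (degree+2≤ n))
    (ℕₚ.≤-trans (ℕₚ.≤-reflexive (≡.cong (x ℕ.+_) (≡.sym (ℕₚ.+-identityʳ x)))) (ℕₚ.*-monoˡ-≤ x FF.2≤s)))
    where x = q ℕ.^ suc n

  D<N : degree j ℕ.< N
  D<N = ℕ.s≤s⁻¹ (≡.subst (2 ℕ.+ degree j ℕ.≤_) q^m≡N+1 (degree+2≤ j))

  -- Each period contains a single 1, placed at the degree of the product of the `frob d`, so the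
  -- product carries this sequence to one whose value at 0 is 1.
  indicator : Sequence
  indicator n with n % N ℕₚ.≟ degree j
  ... | yes _ = 1#
  ... | no  _ = 0#

  indicator-cong : ∀ {n n′} → n % N ≡ n′ % N → indicator n ≈ indicator n′
  indicator-cong {n} {n′} eq with n % N ℕₚ.≟ degree j | n′ % N ℕₚ.≟ degree j
  ... | yes _ | yes _ = refl
  ... | no  _ | no  _ = refl
  ... | yes e | no ¬e = contradiction (≡.trans (≡.sym eq) e) ¬e
  ... | no ¬e | yes e = contradiction (≡.trans eq e) ¬e

  indicator-periodic : Periodic indicator
  indicator-periodic n = indicator-cong {N ℕ.+ n} {n} (≡.trans (≡.cong (_% N) (ℕₚ.+-comm N n)) ([m+n]%n≡m%n n N))

  indicator-below : ∀ i → i ℕ.< degree j → indicator i ≈ 0#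
  indicator-below i i<D with i % N ℕₚ.≟ degree j
  ... | yes e = contradiction (≡.trans (≡.sym (m<n⇒m%n≡m (ℕₚ.<-trans i<D D<N))) e) (ℕₚ.<⇒≢ i<D)
  ... | no  _ = refl

  indicator-at : indicator (degree j) ≈ 1#
  indicator-at with degree j % N ℕₚ.≟ degree j
  ... | yes _ = refl
  ... | no ¬e = contradiction (m<n⇒m%n≡m D<N) ¬e

  initial : Sequence
  initial = frobs j indicator

  initial≢0 : ¬ (initial ≐ 0ˢ)
  initial≢0 eq = FF.1≉0 (trans (sym indicator-at) (trans (sym (frobs-leading j indicator-below)) (eq 0)))

  private module V = FiniteSetoid (vector-finite FF.finite N)

  enumeration : Fin (q ℕ.^ N) → Poly
  enumeration i = tabulate (V.to i)

  act-tabulate-cong : ∀ {n} {u v : Vector Carrier n} → (∀ i → u i ≈ v i) → ∀ s → act (tabulate u) s ≐ act (tabulate v) s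
  act-tabulate-cong {zero}  eq s i = refl
  act-tabulate-cong {suc n} eq s i = +-cong (*-congʳ (eq zero)) (act-tabulate-cong (eq ∘ suc) s (suc i))

  act-tabulate-0 : ∀ n s → act (tabulate {n = n} (λ _ → 0#)) s ≐ 0ˢ
  act-tabulate-0 zero    s i = refl
  act-tabulate-0 (suc n) s i = trans (+-cong (zeroˡ _) (act-tabulate-0 n s (suc i))) (+-identityˡ 0#)

  act-tabulate-last : ∀ {n} (v : Vector Carrier (suc n)) s i →
    act (tabulate v) s i ≈ act (tabulate (v ∘ inject₁)) s i + v (fromℕ n) * s (n ℕ.+ i)
  act-tabulate-last {zero}  v s i = +-comm _ _
  act-tabulate-last {suc n} v s i = trans (+-congˡ (trans (act-tabulate-last (v ∘ suc) s (suc i))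
    (+-congˡ (*-congˡ (reflexive (≡.cong s (ℕₚ.+-suc n i))))))) (sym (+-assoc _ _ _))

  -- The remainder modulo `T ^ N - 1`, which kills every periodic sequence: multiplication by `T`
  -- rotates the `N` coefficients, and the last one wraps around to the constant term.
  reduce : Poly → Vector Carrier N
  reduce []      = λ _ → 0#
  reduce (a ∷ f) = (a + reduce f (fromℕ N′)) ∷ᵛ (reduce f ∘ inject₁)

  reduce-∼ : ∀ f {δ} → Periodic δ → act (tabulate (reduce f)) δ ≐ act f δ
  reduce-∼ []      {δ} per i = act-tabulate-0 N δ i
  reduce-∼ (a ∷ f) {δ} per i = begin
    (a + v (fromℕ N′)) * δ i + act (tabulate (v ∘ inject₁)) δ (suc i)
      ≈⟨ solve 4 (λ a b d x → (a :+ b) :* d :+ x := a :* d :+ (x :+ b :* d)) refl a (v (fromℕ N′)) (δ i) _ ⟩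
    a * δ i + (act (tabulate (v ∘ inject₁)) δ (suc i) + v (fromℕ N′) * δ i)
      ≈⟨ +-congˡ (+-congˡ (*-congˡ (trans (reflexive (≡.cong δ (ℕₚ.+-suc N′ i))) (per i)))) ⟨
    a * δ i + (act (tabulate (v ∘ inject₁)) δ (suc i) + v (fromℕ N′) * δ (N′ ℕ.+ suc i))
      ≈⟨ +-congˡ (trans (sym (act-tabulate-last v δ (suc i))) (reduce-∼ f per (suc i))) ⟩
    a * δ i + act f δ (suc i) ∎
    where v = reduce f

  exhaustive : ∀ {δ} → Periodic δ → ∀ f → ∃ λ i → act (enumeration i) δ ≐ act f δ
  exhaustive {δ} per f = V.from (reduce f) , λ n →
    trans (act-tabulate-cong (V.to-from (reduce f)) δ n) (reduce-∼ f per n)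

  -- The quotient is first shown to be a field of some dimension `d`; the order and the dimension
  -- are transported along `d≡m` afterwards.
  extension : Extension R q m
  extension with δ , per , δ≢0 , keep , split ←
    refine enumeration (frobs-periodic j indicator-periodic) initial≢0 = record
      { K             = K
      ; hom           = constants
      ; isFiniteField = ≡.subst (λ d → IsFiniteField K (q ℕ.^ d)) d≡m isFiniteFieldK
      ; hasDim        = ≡.subst (HasDim M (whole M)) d≡m (proj₂ dimension)
      }
    where
    open Quotient δ renaming (commutativeRing to K)
    module K = CommutativeRing K
    module KL = RingLemmas K
    M = RingHom.restrictScalars constants
    module LA = LinearAlgebra isFiniteField M

    _≟_ : ∀ f g → Dec (f ∼ g)
    f ≟ g = periodic-≐? (act-periodic f per) (act-periodic g per)

    dimension : ∃ λ d → HasDim M (whole M) d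
    dimension = LA.decidable⇒dim enumeration (exhaustive per) _≟_ (whole M) (λ _ → yes _)
    d = proj₁ dimension
    basis = proj₂ (proj₂ dimension)

    1∼ : act (const 1#) δ ≐ δ
    1∼ n = trans (act-const 1# δ n) (*-identityˡ _)

    1≁0 : ¬ (const 1# ∼ [])
    1≁0 eq = δ≢0 (λ n → trans (sym (1∼ n)) (eq n))

    regular⇒power∼1 : ∀ {z} → Regular z δ → z KL.^ N ∼ const 1#
    regular⇒power∼1 {z} reg n = trans (reflexive (≡.cong (λ f → act f δ n) (≡.sym (power≡^ δ z N)))) (trans (reg n) (sym (1∼ n)))

    isFiniteFieldK : IsFiniteField K (q ℕ.^ d)
    isFiniteFieldK = record
      { finite = LA.Coordinates.finite {v = proj₁ (proj₂ dimension)} basis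
      ; 1≉0    = 1≁0
      ; invert = invert
      }
      where
      invert : ∀ f → ¬ (f ∼ []) → ∃ λ g → f ⊗ g ∼ const 1#
      invert f f≁0 with i , i∼f ← exhaustive per f with split i
      ... | inj₁ z≐0 = contradiction (λ n → trans (sym (i∼f n)) (z≐0 n)) f≁0
      -- Since `N = suc N′`, the relation `z ^ N = 1` for the representative `z` of `f` exhibits
      -- `z ^ N′` as an inverse.
      ... | inj₂ reg = enumeration i KL.^ N′ ,
        K.trans {f ⊗ enumeration i KL.^ N′} {enumeration i ⊗ enumeration i KL.^ N′} {const 1#}
          (K.*-congʳ {enumeration i KL.^ N′} {f} {enumeration i} (λ n → sym (i∼f n)))
          (regular⇒power∼1 {enumeration i} reg)

    module KF = FiniteField isFiniteFieldK

    d≤m : d ℕ.≤ m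
    d≤m = ^-cancelˡ-≤ d m FF.2≤s (KF.fixed-points≤ (FF.2≤s^ j) KF.to
      (λ i i′ eq → ≡.trans (≡.sym (KF.from-to i)) (≡.trans (KF.from-cong {KF.to i} {KF.to i′} eq) (KF.from-to i′)))
      (λ i → pow-fixed per (KF.to i)))

    0<d : 0 ℕ.< d
    0<d = ℕₚ.n≢0⇒n>0 λ d≡0 → ℕₚ.<⇒≱ KF.2≤s (ℕₚ.≤-reflexive (≡.cong (q ℕ.^_) d≡0))

    m≤d : m ℕ.≤ d
    m≤d with m ℕₚ.≤? d | d in d≡ | 0<d
    ... | yes m≤d | _ | _ = ≡.subst (m ℕ.≤_) d≡ m≤d
    -- For `d < m` the element `frob d` would be 0, by Fermat's theorem in a field of order `q ^ d`,
    -- and at the same time an `N`-th root of 1.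
    ... | no  m≰d | suc d′ | _ = contradiction
      (K.trans {const 1#} {frob (suc d′) KL.^ N} {[]}
        (K.sym {frob (suc d′) KL.^ N} {const 1#} (regular⇒power∼1 {frob (suc d′)} reg))
        (K.trans {frob (suc d′) KL.^ N} {[] KL.^ N} {[]} (KL.^-congˡ N {frob (suc d′)} {[]} frob∼0) (KL.0^n≈0 N)))
      1≁0
      where
      reg : Regular (frob (suc d′)) δ
      reg = keep (frob (suc d′)) (frob-regular j indicator-periodic d′ (ℕ.s≤s⁻¹ (ℕₚ.≰⇒> (≡.subst (λ d → ¬ (m ℕ.≤ d)) d≡ m≰d))))
      frob∼0 : frob (suc d′) ∼ []
      frob∼0 = KL.x≈y⇒x-y≈0 {power T (q ℕ.^ suc d′)} {T}
        (λ n → trans (reflexive (≡.cong (λ f → act f δ n) (power≡^ δ T (q ℕ.^ suc d′))))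
          (≡.subst (λ d → T KL.^ (q ℕ.^ d) ∼ T) d≡ (KF.fermat T) n))

    d≡m : d ≡ m
    d≡m = ℕₚ.≤-antisym d≤m m≤d

exists-extension : ∀ {c ℓ} {R : CommutativeRing c ℓ} {q} → PrimePower q → IsFiniteField R q →
                   ∀ m → 1 ℕ.≤ m → Extension R q m
exists-extension {R = R} {q} (p , k , pp , _ , q≡p^k) isFiniteField (suc j) _ = go (q ℕ.^ suc j) ≡.refl
    (FiniteField.2≤s^ isFiniteField j)
  where
  go : ∀ Q → q ℕ.^ suc j ≡ Q → 2 ℕ.≤ Q → Extension R q (suc j)
  go (suc (suc N′)) eq _ = Construction.extension isFiniteField {p} {k} pp q≡p^k j N′ eq
  go (suc zero)     eq (ℕ.s≤s ())

-- The spread and the evasive subspace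

module Frobenius {c ℓ} {R : CommutativeRing c ℓ} {q m} (primePower : PrimePower q)
                 (isFiniteField : IsFiniteField R q) (extension : Extension R q m) where
  open Extension extension using (K; hom; hasDim) renaming (isFiniteField to isFiniteFieldK) public
  open RingHom hom public
  private
    module F  = CommutativeRing R
    module FF = FiniteField isFiniteField
    module KF = FiniteField isFiniteFieldK
  open CommutativeRing K hiding (zero)
  open RingLemmas K

  σ : Carrier → Carrier
  σ x = x ^ q

  σ-cong : ∀ {x y} → x ≈ y → σ x ≈ σ y
  σ-cong = ^-congˡ q

  σ-+ : ∀ x y → σ (x + y) ≈ σ x + σ y
  σ-+ x y = let (p , k , pp , _ , q≡p^k) = primePower in
    ≡.subst (λ q → (x + y) ^ q ≈ x ^ q + y ^ q) (≡.sym q≡p^k)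
      (Characteristic.^p^k-distrib-+ pp (characteristic {p} (FF.^-p·1 p k q≡p^k)) k x y)

  σ-* : ∀ x y → σ (x * y) ≈ σ x * σ y
  σ-* x y = ^-distrib-* x y q

  σ≈0⇒≈0 : ∀ {x} → σ x ≈ 0# → x ≈ 0#
  σ≈0⇒≈0 = KF.x^n≈0⇒x≈0 q

  σ-0 : ∀ {x} → x ≈ 0# → σ x ≈ 0#
  σ-0 x≈0 = trans (σ-cong x≈0) (0^n≈0 q {{ℕ.>-nonZero (ℕₚ.≤-trans (ℕ.s≤s ℕ.z≤n) FF.2≤s)}})

  σ-scalar : ∀ a → σ ⟦ a ⟧ ≈ ⟦ a ⟧
  σ-scalar a = trans (sym (⟦⟧-^ a q)) (⟦⟧-cong (FF.fermat a))

  ⟦⟧-kernel : ∀ {a} → ⟦ a ⟧ ≈ 0# → a F.≈ F.0#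
  ⟦⟧-kernel {a} ⟦a⟧≈0 with a FF.≟ F.0#
  ... | yes a≈0 = a≈0
  ... | no  a≉0 with b , ab≈1 ← FF.invert a a≉0 = contradiction
    (trans (sym ⟦⟧-1) (trans (⟦⟧-cong (F.sym ab≈1)) (trans (⟦⟧-* a b) (trans (*-congʳ ⟦a⟧≈0) (zeroˡ _))))) KF.1≉0

  ⟦⟧-injective : ∀ {a b} → ⟦ a ⟧ ≈ ⟦ b ⟧ → a F.≈ b
  ⟦⟧-injective {a} {b} eq = RingLemmas.x-y≈0⇒x≈y R a b (⟦⟧-kernel (begin
    ⟦ a F.- b ⟧                        ≈⟨ x+y-y≈x _ ⟦ b ⟧ ⟨
    (⟦ a F.- b ⟧ + ⟦ b ⟧) - ⟦ b ⟧      ≈⟨ +-congʳ (⟦⟧-+ _ _) ⟨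
    ⟦ (a F.- b) F.+ b ⟧ - ⟦ b ⟧        ≈⟨ +-congʳ (trans (⟦⟧-cong (RingLemmas.x-y+y≈x R a b)) eq) ⟩
    ⟦ b ⟧ - ⟦ b ⟧                      ≈⟨ -‿inverseʳ _ ⟩
    0#                                 ∎))
    where open SetoidReasoning setoid

  -- The q elements of F already exhaust the roots of x^q - x.
  σ-fixed : ∀ {t} → σ t ≈ t → ∃ λ a → t ≈ ⟦ a ⟧
  σ-fixed {t} fixed with FF.∃? {P = λ a → t ≈ ⟦ a ⟧} (λ a≈b eq → trans eq (⟦⟧-cong a≈b)) (λ a → t KF.≟ ⟦ a ⟧)
  ... | yes t∈F = t∈F
  ... | no  t∉F = contradiction (KF.fixed-points≤ FF.2≤s roots injective
    (λ { zero → fixed ; (suc i) → σ-scalar (FF.to i) })) ℕₚ.1+n≰n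
    where
    roots : Fin (suc q) → Carrier
    roots zero    = t
    roots (suc i) = ⟦ FF.to i ⟧
    injective : ∀ i j → roots i ≈ roots j → i ≡ j
    injective zero    zero    eq = ≡.refl
    injective zero    (suc j) eq = contradiction (FF.to j , eq) t∉F
    injective (suc i) zero    eq = contradiction (FF.to i , sym eq) t∉F
    injective (suc i) (suc j) eq = ≡.cong suc (≡.trans (≡.sym (FF.from-to i))
      (≡.trans (FF.from-cong (⟦⟧-injective eq)) (FF.from-to j)))

  -- As a function of `t`, a linearised polynomial of `q`-degree at most 1; it is linear over the
  -- base field.
  skew : Carrier → Carrier → Carrier → Carrier
  skew b c t = t * b + σ t * c

  skew-cong : ∀ {b c t u} → t ≈ u → skew b c t ≈ skew b c u
  skew-cong t≈u = +-cong (*-congʳ t≈u) (*-congʳ (σ-cong t≈u))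

  skew-+ : ∀ b c t u → skew b c (t + u) ≈ skew b c t + skew b c u
  skew-+ b c t u = trans (+-congˡ (*-congʳ (σ-+ t u)))
    (solve 6 (λ b c t u s v → (t :+ u) :* b :+ (s :+ v) :* c := (t :* b :+ s :* c) :+ (u :* b :+ v :* c)) refl
      b c t u (σ t) (σ u))

  skew-scalar : ∀ b c a t → skew b c (⟦ a ⟧ * t) ≈ ⟦ a ⟧ * skew b c t
  skew-scalar b c a t = trans (+-congˡ (*-congʳ (trans (σ-* _ _) (*-congʳ (σ-scalar a)))))
    (solve 5 (λ a b c t s → (a :* t) :* b :+ (a :* s) :* c := a :* (t :* b :+ s :* c)) refl ⟦ a ⟧ b c t (σ t))

  -- With `w = t / u`, subtracting `w` times the equation for `u` from the one for `t` leaves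
  -- `σ u c (σ w - w) = 0`. Here `c ≠ 0`, since otherwise `u b = 0` would force `b = 0` as well.
  skew-kernel : ∀ b c → ¬ (b ≈ 0# × c ≈ 0#) → ∀ {t u} → ¬ (u ≈ 0#) →
                skew b c t ≈ 0# → skew b c u ≈ 0# → ∃ λ a → t ≈ ⟦ a ⟧ * u
  skew-kernel b c bc≉0 {t} {u} u≉0 t∈ker u∈ker with v , uv≈1 ← KF.invert u u≉0 =
    let (a , w≈a) = σ-fixed {w} (KF.cancelˡ (σ u * c) σuc≉0 σw≈w) in a , trans (sym wu≈t) (*-congʳ w≈a)
    where
    open SetoidReasoning setoid
    w = t * v
    wu≈t : w * u ≈ t
    wu≈t = trans (*-assoc _ _ _) (trans (*-congˡ (trans (*-comm _ _) uv≈1)) (*-identityʳ t))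
    c≉0 : ¬ (c ≈ 0#)
    c≉0 c≈0 = bc≉0 (KF.x≉0∧xy≈0⇒y≈0 u≉0
      (trans (sym (trans (+-congˡ (trans (*-congˡ c≈0) (zeroʳ _))) (+-identityʳ _))) u∈ker) , c≈0)
    σuc≉0 : ¬ (σ u * c ≈ 0#)
    σuc≉0 = c≉0 ∘ KF.x≉0∧xy≈0⇒y≈0 (u≉0 ∘ σ≈0⇒≈0)
    wub = w * (u * b)
    σw≈w : (σ u * c) * σ w ≈ (σ u * c) * w
    σw≈w = begin
      (σ u * c) * σ w                   ≈⟨ x+y-x≈y wub _ ⟨
      (wub + (σ u * c) * σ w) - wub     ≈⟨ +-congʳ (trans (sym regroup) (trans (skew-cong wu≈t) t∈ker)) ⟩
      0# - wub                          ≈⟨ +-congʳ (trans (sym (zeroʳ w)) (trans (*-congˡ (sym u∈ker))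
                                             (solve 4 (λ w u b y → w :* (u :* b :+ y) := w :* (u :* b) :+ y :* w) refl w u b (σ u * c)))) ⟩
      (wub + (σ u * c) * w) - wub       ≈⟨ x+y-x≈y wub _ ⟩
      (σ u * c) * w                     ∎
      where
      regroup : skew b c (w * u) ≈ wub + (σ u * c) * σ w
      regroup = trans (+-congˡ (*-congʳ (σ-* w u)))
        (solve 6 (λ w u b s v c → (w :* u) :* b :+ (s :* v) :* c := w :* (u :* b) :+ (v :* c) :* s) refl
          w u b (σ w) (σ u) c)

  pivot : ∀ {n} → Vector Carrier n → Carrier
  pivot {zero}  v = 0#
  pivot {suc n} v with v zero KF.≟ 0#
  ... | yes _ = pivot (v ∘ suc)
  ... | no  _ = v zero

  pivot-cong : ∀ {n} {u v : Vector Carrier n} → (∀ i → u i ≈ v i) → pivot u ≈ pivot v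
  pivot-cong {zero}          eq = refl
  pivot-cong {suc n} {u} {v} eq with u zero KF.≟ 0# | v zero KF.≟ 0#
  ... | yes _   | yes _   = pivot-cong (eq ∘ suc)
  ... | no  _   | no  _   = eq zero
  ... | yes u≈0 | no  v≉0 = contradiction (trans (sym (eq zero)) u≈0) v≉0
  ... | no  u≉0 | yes v≈0 = contradiction (trans (eq zero) v≈0) u≉0

  pivot-0 : ∀ {n} {v : Vector Carrier n} → (∀ i → v i ≈ 0#) → pivot v ≈ 0#
  pivot-0 {zero}      v≈0 = refl
  pivot-0 {suc n} {v} v≈0 with v zero KF.≟ 0#
  ... | yes _    = pivot-0 (v≈0 ∘ suc)
  ... | no  v0≉0 = v≈0 zero

  pivot≈0⇒≈0 : ∀ {n} {v : Vector Carrier n} → pivot v ≈ 0# → ∀ i → v i ≈ 0#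
  pivot≈0⇒≈0 {suc n} {v} eq i with v zero KF.≟ 0#
  pivot≈0⇒≈0 eq zero    | yes v0≈0 = v0≈0
  pivot≈0⇒≈0 eq (suc i) | yes _    = pivot≈0⇒≈0 eq i
  pivot≈0⇒≈0 eq i       | no  v0≉0 = contradiction eq v0≉0

  -- For `t ≠ 0` both sides select the same coordinate, because `t * v i` vanishes exactly when
  -- `v i` does.
  pivot-* : ∀ {n} t (v : Vector Carrier n) → pivot (λ i → t * v i) ≈ t * pivot v
  pivot-* {n} t v with t KF.≟ 0#
  ... | yes t≈0 = trans (pivot-0 {n} (λ i → trans (*-congʳ t≈0) (zeroˡ _))) (sym (trans (*-congʳ t≈0) (zeroˡ _)))
  ... | no  t≉0 = go v
    where
    go : ∀ {n} (v : Vector Carrier n) → pivot (λ i → t * v i) ≈ t * pivot v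
    go {zero}  v = sym (zeroʳ t)
    go {suc n} v with t * v zero KF.≟ 0# | v zero KF.≟ 0#
    ... | yes _    | yes _   = go (v ∘ suc)
    ... | no  _    | no  _   = refl
    ... | yes tv≈0 | no  v≉0 = contradiction (KF.x≉0∧xy≈0⇒y≈0 t≉0 tv≈0) v≉0
    ... | no  tv≉0 | yes v≈0 = contradiction (trans (*-congˡ v≈0) (zeroʳ t)) tv≉0

-- The twisted line spread

module Spread {c ℓ₁ a ℓ} {R : CommutativeRing c ℓ₁} {q m n} (primePower : PrimePower q)
              (isFiniteField : IsFiniteField R q) (extension : Extension R q m) (X : Module R a ℓ)
              (hasDimX : HasDim X (whole X) (n ℕ.* m ℕ.+ m)) where
  open Frobenius primePower isFiniteField extension
  open RingLemmas K
  open Module X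
  private
    module F  = CommutativeRing R
    module FF = FiniteField isFiniteField
    module K  = CommutativeRing K
    module KF = FiniteField isFiniteFieldK
    module LX = LinearAlgebra isFiniteField X
    module LK = LinearAlgebra isFiniteField restrictScalars
    module CX = LX.Coordinates (proj₂ hasDimX)
    module CK = LK.Coordinates (proj₂ hasDim)
    e = proj₁ hasDimX
    b = proj₁ hasDim

  open K using (_≈_; _+_; _*_; -_; _-_; 0#; 1#; refl; sym; trans; *-congˡ; *-congʳ; +-cong; +-congˡ; +-congʳ;
                zeroˡ; zeroʳ; *-assoc; *-comm; *-identityˡ)
  open LX using (_⊙_)
  open SetoidReasoning K.setoid

  -- The `n` of this module is the `n - 1` of the theorem.
  Kⁿ : Set c
  Kⁿ = Vector K.Carrier n

  -- X is identified with Kⁿ × K, the last m coordinates of X being those of K.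
  flatten : Kⁿ → K.Carrier → Vector F.Carrier (n ℕ.* m ℕ.+ m)
  flatten x y i =
    [ (λ i → uncurry (λ i j → CK.coordinates (x i) j) (remQuot {n} m i)) , CK.coordinates y ]′ (splitAt (n ℕ.* m) i)

  flatten-last : ∀ x y j → flatten x y ((n ℕ.* m) ↑ʳ j) ≡ CK.coordinates y j
  flatten-last x y j rewrite Finₚ.splitAt-↑ʳ (n ℕ.* m) m j = ≡.refl

  flatten-init : ∀ x y i j → flatten x y (combine i j ↑ˡ m) ≡ CK.coordinates (x i) j
  flatten-init x y i j rewrite Finₚ.splitAt-↑ˡ (n ℕ.* m) (combine i j) m =
    ≡.cong (uncurry λ i j → CK.coordinates (x i) j) (Finₚ.remQuot-combine i j)

  pack : Kⁿ → K.Carrier → Carrierᴹ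
  pack x y = flatten x y ⊙ e

  pack-cong : ∀ {x x′ y y′} → (∀ i → x i ≈ x′ i) → y ≈ y′ → pack x y ≈ᴹ pack x′ y′
  pack-cong {x} {x′} {y} {y′} x≈ y≈ = LX.⊙-congˡ eq
    where
    eq : ∀ i → flatten x y i F.≈ flatten x′ y′ i
    eq i with splitAt (n ℕ.* m) i
    ... | inj₁ i = CK.coordinates-cong (x≈ _) _
    ... | inj₂ j = CK.coordinates-cong y≈ j

  pack-+ : ∀ x x′ y y′ → pack (λ i → x i + x′ i) (y + y′) ≈ᴹ pack x y +ᴹ pack x′ y′
  pack-+ x x′ y y′ = ≈ᴹ-trans (LX.⊙-congˡ eq) (LX.⊙-+ (flatten x y) (flatten x′ y′) e)
    where
    eq : ∀ i → flatten (λ i → x i + x′ i) (y + y′) i F.≈ flatten x y i F.+ flatten x′ y′ i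
    eq i with splitAt (n ℕ.* m) i
    ... | inj₁ i = CK.coordinates-+ _ _ _
    ... | inj₂ j = CK.coordinates-+ y y′ j

  pack-* : ∀ r x y → pack (λ i → ⟦ r ⟧ * x i) (⟦ r ⟧ * y) ≈ᴹ r *ₗ pack x y
  pack-* r x y = ≈ᴹ-trans (LX.⊙-congˡ eq) (LX.⊙-* r (flatten x y) e)
    where
    eq : ∀ i → flatten (λ i → ⟦ r ⟧ * x i) (⟦ r ⟧ * y) i F.≈ r F.* flatten x y i
    eq i with splitAt (n ℕ.* m) i
    ... | inj₁ i = CK.coordinates-* r _ _
    ... | inj₂ j = CK.coordinates-* r y j

  pack-injective : ∀ {x x′ y y′} → pack x y ≈ᴹ pack x′ y′ → (∀ i → x i ≈ x′ i) × y ≈ y′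
  pack-injective {x} {x′} {y} {y′} eq =
      (λ i → CK.coordinates-injective λ j →
        ≡.subst₂ F._≈_ (flatten-init x y i j) (flatten-init x′ y′ i j) (flat (combine i j ↑ˡ m)))
    , CK.coordinates-injective λ j →
        ≡.subst₂ F._≈_ (flatten-last x y j) (flatten-last x′ y′ j) (flat ((n ℕ.* m) ↑ʳ j))
    where flat = LX.⊙-injective (IsBasis.independent (proj₂ hasDimX)) eq

  pack-surjective : ∀ z → ∃₂ λ x y → z ≈ᴹ pack x y
  pack-surjective z = x , y , ≈ᴹ-trans (≈ᴹ-sym (CX.⊙-coordinates z)) (LX.⊙-congˡ eq)
    where
    x : Kⁿ
    x i = (λ j → CX.coordinates z (combine i j ↑ˡ m)) LK.⊙ b
    y = (λ j → CX.coordinates z ((n ℕ.* m) ↑ʳ j)) LK.⊙ b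
    eq : ∀ i → CX.coordinates z i F.≈ flatten x y i
    eq i with splitAt (n ℕ.* m) i | Finₚ.join-splitAt (n ℕ.* m) m i
    ... | inj₁ k | ≡.refl = F.trans
      (F.reflexive (≡.cong (λ k → CX.coordinates z (k ↑ˡ m)) (≡.sym (Finₚ.combine-remQuot {n} m k))))
      (F.sym (CK.coordinates-unique _ refl _))
    ... | inj₂ j | ≡.refl = F.sym (CK.coordinates-unique _ refl j)

  pack-last : ∀ x y j → CX.coordinates (pack x y) ((n ℕ.* m) ↑ʳ j) F.≈ CK.coordinates y j
  pack-last x y j = F.trans (CX.coordinates-unique (flatten x y) ≈ᴹ-refl _) (F.reflexive (flatten-last x y j))

  pack-0 : ∀ {x y} → (∀ i → x i ≈ 0#) → y ≈ 0# → pack x y ≈ᴹ 0ᴹ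
  pack-0 {x} {y} x≈0 y≈0 = ≈ᴹ-trans
    (pack-cong (λ i → trans (x≈0 i) (sym (trans (*-congʳ ⟦⟧-0) (zeroˡ (x i)))))
               (trans y≈0 (sym (trans (*-congʳ ⟦⟧-0) (zeroˡ y)))))
    (≈ᴹ-trans (pack-* F.0# x y) (*ₗ-zeroˡ _))

  -- (x , y) ↦ (x , y - twist x) maps the points point x y t to the K-line through (x , y).
  twist : Kⁿ → K.Carrier
  twist x = - σ (pivot x)

  point : Kⁿ → K.Carrier → K.Carrier → Carrierᴹ
  point x y t = pack (λ i → t * x i) (skew y (twist x) t)

  NonZero : Kⁿ → K.Carrier → Set ℓ₁
  NonZero x y = ¬ ((∀ i → x i ≈ 0#) × y ≈ 0#)

  twist-scale : ∀ {x x′} r → (∀ i → x i ≈ r * x′ i) → twist x ≈ σ r * twist x′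
  twist-scale {x} {x′} r x≈rx′ = trans
    (K.-‿cong (trans (σ-cong (trans (pivot-cong x≈rx′) (pivot-* r x′))) (σ-* r (pivot x′))))
    (-‿distribʳ-* (σ r) (σ (pivot x′)))

  twist≈0⇒≈0 : ∀ {x} → twist x ≈ 0# → ∀ i → x i ≈ 0#
  twist≈0⇒≈0 {x} eq = pivot≈0⇒≈0 (σ≈0⇒≈0
    (trans (sym (trans (+-congˡ eq) (K.+-identityʳ _))) (K.-‿inverseʳ (σ (pivot x)))))

  twist-0 : ∀ {x} → (∀ i → x i ≈ 0#) → twist x ≈ 0#
  twist-0 x≈0 = trans (K.-‿cong (σ-0 (pivot-0 x≈0))) -0≈0

  module _ (x : Kⁿ) (y : K.Carrier) where

    point-cong : ∀ {t u} → t ≈ u → point x y t ≈ᴹ point x y u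
    point-cong {t} {u} t≈u = pack-cong {λ i → t * x i} {λ i → u * x i} (λ i → *-congʳ t≈u) (skew-cong t≈u)

    point-+ : ∀ t u → point x y (t + u) ≈ᴹ point x y t +ᴹ point x y u
    point-+ t u = ≈ᴹ-trans
      (pack-cong {λ i → (t + u) * x i} {λ i → t * x i + u * x i} (λ i → K.distribʳ (x i) t u) (skew-+ y (twist x) t u))
      (pack-+ (λ i → t * x i) (λ i → u * x i) _ _)

    point-scalar : ∀ r t → point x y (⟦ r ⟧ * t) ≈ᴹ r *ₗ point x y t
    point-scalar r t = ≈ᴹ-trans
      (pack-cong {λ i → (⟦ r ⟧ * t) * x i} {λ i → ⟦ r ⟧ * (t * x i)}
        (λ i → *-assoc ⟦ r ⟧ t (x i)) (skew-scalar y (twist x) r t))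
      (pack-* r (λ i → t * x i) _)

    point-0 : ∀ {t} → t ≈ 0# → point x y t ≈ᴹ 0ᴹ
    point-0 {t} t≈0 = pack-0 {λ i → t * x i} (λ i → trans (*-congʳ t≈0) (zeroˡ _))
      (trans (+-cong (trans (*-congʳ t≈0) (zeroˡ _)) (trans (*-congʳ (σ-0 t≈0)) (zeroˡ _))) (K.+-identityˡ 0#))

    -- If `t ≠ 0`, the first component gives `x = 0`; then the twist vanishes and the last component
    -- reduces to `t y = 0`.
    point≈0⇒≈0 : NonZero x y → ∀ {t} → point x y t ≈ᴹ 0ᴹ → t ≈ 0#
    point≈0⇒≈0 xy≉0 {t} eq with t KF.≟ 0#
    ... | yes t≈0 = t≈0
    ... | no  t≉0 with tx≈0 , skew≈0 ← pack-injective (≈ᴹ-trans eq (≈ᴹ-sym (pack-0 {λ _ → 0#} (λ _ → refl) refl))) =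
      contradiction (x≈0 , KF.x≉0∧xy≈0⇒y≈0 t≉0 (trans (sym (trans
        (+-congˡ (trans (*-congˡ (twist-0 x≈0)) (zeroʳ _))) (K.+-identityʳ _))) skew≈0)) xy≉0
      where
      x≈0 : ∀ i → x i ≈ 0#
      x≈0 i = KF.x≉0∧xy≈0⇒y≈0 t≉0 (tx≈0 i)

    line : Subspace X
    line = record
      { member    = λ z → Lift (c ⊔ ℓ₁ ⊔ a ⊔ ℓ) (∃ λ t → z ≈ᴹ point x y t)
      ; resp-≈ᴹ   = λ z≈z′ (lift (t , eq)) → lift (t , ≈ᴹ-trans (≈ᴹ-sym z≈z′) eq)
      ; 0ᴹ-closed = lift (0# , ≈ᴹ-sym (point-0 refl))
      ; +ᴹ-closed = λ (lift (t , eq)) (lift (u , eq′)) → lift (t + u , ≈ᴹ-trans (+ᴹ-cong eq eq′) (≈ᴹ-sym (point-+ t u)))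
      ; *ₗ-closed = λ r (lift (t , eq)) → lift (⟦ r ⟧ * t , ≈ᴹ-trans (*ₗ-cong F.refl eq) (≈ᴹ-sym (point-scalar r t)))
      }

    line? : Decidable (Subspace.member line)
    line? z = map′ lift lower (KF.∃? {P = λ t → z ≈ᴹ point x y t} (λ t≈u eq → ≈ᴹ-trans eq (point-cong t≈u))
      (λ t → FX._≟_ z (point x y t)))
      where module FX = FiniteSetoid CX.finite

    line-dim : NonZero x y → HasDim X line m
    line-dim xy≉0 = LX.isomorphism⇒dim line (λ r → point x y (r LK.⊙ b))
      (λ eq → point-cong (LK.⊙-congˡ eq))
      (λ r r′ → ≈ᴹ-trans (point-cong (LK.⊙-+ r r′ b)) (point-+ _ _))
      (λ s r → ≈ᴹ-trans (point-cong (LK.⊙-* s r b)) (point-scalar s _))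
      (λ r → lift (_ , ≈ᴹ-refl))
      (λ r eq → IsBasis.independent (proj₂ hasDim) r (point≈0⇒≈0 xy≉0 eq))
      (λ (lift (t , eq)) → CK.coordinates t , ≈ᴹ-trans eq (point-cong (sym (CK.⊙-coordinates t))))

  -- The twist scales by `σ r`, which is the factor between `σ t` and `σ (t r)`. Hence passing to a
  -- `K`-multiple of the pair only changes the parameter.
  point-rescale : ∀ {x x′ y y′} r → (∀ i → x i ≈ r * x′ i) → y ≈ r * y′ → ∀ t → point x y t ≈ᴹ point x′ y′ (t * r)
  point-rescale {x} {x′} {y} {y′} r x≈ y≈ t = pack-cong
    (λ i → trans (*-congˡ (x≈ i)) (sym (*-assoc t r (x′ i))))
    (+-cong (trans (*-congˡ y≈) (sym (*-assoc t r y′)))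
      (trans (*-congˡ (twist-scale r x≈)) (trans (sym (*-assoc _ _ _)) (*-congʳ (sym (σ-* t r))))))

  -- The term `σ t * twist x` is the twist of the vector `t x`, so the first components determine it
  -- and it can be subtracted.
  point-injective : ∀ {x x′ y y′ t t′} → point x y t ≈ᴹ point x′ y′ t′ →
                    (∀ i → t * x i ≈ t′ * x′ i) × t * y ≈ t′ * y′
  point-injective {x} {x′} {y} {y′} {t} {t′} eq with tx≈ , skew≈ ← pack-injective eq = tx≈ , (begin
    t * y                                        ≈⟨ x+y-y≈x _ _ ⟨
    (t * y + σ t * twist x) - σ t * twist x      ≈⟨ +-cong skew≈ (K.-‿cong twist≈) ⟩
    (t′ * y′ + σ t′ * twist x′) - σ t′ * twist x′ ≈⟨ x+y-y≈x _ _ ⟩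
    t′ * y′                                      ∎)
    where
    twist≈ : σ t * twist x ≈ σ t′ * twist x′
    twist≈ = trans (sym (twist-scale t (λ _ → refl))) (trans (K.-‿cong (σ-cong (pivot-cong tx≈))) (twist-scale t′ (λ _ → refl)))

  -- The common vector `z` forces `t ≠ 0`, and comparing its two descriptions gives
  -- `(x , y) = (t′ / t) (x′ , y′)`; every other parameter is then converted by `point-rescale`.
  lines-⊆ : ∀ {x x′ y y′ z} → ¬ (z ≈ᴹ 0ᴹ) → z ∈ Subspace.member (line x y) → z ∈ Subspace.member (line x′ y′) →
            ∀ {w} → w ∈ Subspace.member (line x y) → w ∈ Subspace.member (line x′ y′)
  lines-⊆ {x} {x′} {y} {y′} z≉0 (lift (t , z≈t)) (lift (t′ , z≈t′)) (lift (u , w≈u))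
    with v , tv≈1 ← KF.invert t (λ t≈0 → z≉0 (≈ᴹ-trans z≈t (point-0 x y t≈0)))
    with tx≈ , ty≈ ← point-injective {x} {x′} {y} {y′} {t} {t′} (≈ᴹ-trans (≈ᴹ-sym z≈t) z≈t′) =
    lift (_ , ≈ᴹ-trans w≈u (point-rescale (v * t′) (λ i → solve-t (tx≈ i)) (solve-t ty≈) u))
    where
    solve-t : ∀ {x x′} → t * x ≈ t′ * x′ → x ≈ (v * t′) * x′
    solve-t {x} {x′} eq = trans (sym (trans (sym (*-assoc v t x)) (trans (*-congʳ (trans (*-comm v t) tv≈1)) (*-identityˡ x))))
      (trans (*-congˡ eq) (sym (*-assoc v t′ x′)))

  lines-≋ : ∀ {x x′ y y′ z} → ¬ (z ≈ᴹ 0ᴹ) → z ∈ Subspace.member (line x y) → z ∈ Subspace.member (line x′ y′) →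
            _≋_ X (line x y) (line x′ y′)
  lines-≋ z≉0 z∈ z∈′ = lines-⊆ z≉0 z∈ z∈′ , lines-⊆ z≉0 z∈′ z∈

  𝒜 : Collection X
  𝒜 S = ∃₂ λ x y → NonZero x y × _≋_ X S (line x y)

  isSpread : IsSpread X m 𝒜
  isSpread = record
    { resp-≋       = λ (S⊆T , T⊆S) (x , y , xy≉0 , (S⊆l , l⊆S)) → x , y , xy≉0 , (S⊆l ∘ T⊆S , S⊆T ∘ l⊆S)
    ; dimension    = λ (x , y , xy≉0 , (S⊆l , l⊆S)) → LX.HasDim-resp-≋ (l⊆S , S⊆l) (line-dim x y xy≉0)
    ; disjoint     = λ {S} {T} → disjoint {S} {T}
    ; partitioning = partitioning
    }
    where
    module FX = FiniteSetoid CX.finite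

    disjoint : ∀ {S T} → S ∈ 𝒜 → T ∈ 𝒜 → ¬ (_≋_ X S T) →
      ∀ {z} → z ∈ Subspace.member S → z ∈ Subspace.member T → z ≈ᴹ 0ᴹ
    disjoint (x , y , _ , (S⊆l , l⊆S)) (x′ , y′ , _ , (T⊆l , l⊆T)) S≢T {z} z∈S z∈T = decidable-stable (FX._≟_ z 0ᴹ) λ z≉0 →
      let (l⊆l′ , l′⊆l) = lines-≋ z≉0 (S⊆l z∈S) (T⊆l z∈T) in S≢T (l⊆T ∘ l⊆l′ ∘ S⊆l , l⊆S ∘ l′⊆l ∘ T⊆l)

    partitioning : ∀ z → ¬ (z ≈ᴹ 0ᴹ) → ∃! (_≋_ X) λ S → S ∈ 𝒜 × z ∈ Subspace.member S
    partitioning z z≉0 with x , y , z≈ ← pack-surjective z = line x y₀ ,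
      ((x , y₀ , xy₀≉0 , (id , id)) , z∈l) ,
      λ ((x′ , y′ , _ , (S⊆l , l⊆S)) , z∈S) → let (l⊆l′ , l′⊆l) = lines-≋ z≉0 z∈l (S⊆l z∈S) in (l⊆S ∘ l⊆l′ , l′⊆l ∘ S⊆l)
      where
      -- As `σ 1 = 1`, the point with parameter 1 has last component `y₀ + twist x`, which has to be
      -- `y`.
      y₀ = y - twist x
      z∈l : z ∈ Subspace.member (line x y₀)
      z∈l = lift (1# , ≈ᴹ-trans z≈ (pack-cong (λ i → sym (*-identityˡ (x i)))
        (sym (trans (+-cong (*-identityˡ y₀) (trans (*-congʳ (1^n≈1 q)) (*-identityˡ _))) (x-y+y≈x y (twist x))))))
      xy₀≉0 : NonZero x y₀
      xy₀≉0 (x≈0 , y₀≈0) = z≉0 (≈ᴹ-trans z≈ (pack-0 x≈0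
        (trans (sym (x-0≈x y)) (trans (+-congˡ (K.-‿cong (sym (twist-0 x≈0)))) y₀≈0))))

  -- The evasive subspace and its intersections with the lines

  module Evasive {h₁} (h₁<m : h₁ ℕ.< m) where
    private
      module UX = LX.LeadingCoordinates (proj₂ hasDimX)

    -- With `h₁ = h - 1`. Since `flatten` puts the coordinates of `K` last, this is `Kⁿ × W`, where
    -- `W` is spanned by the first `h₁` basis vectors of `K`.
    U : Subspace X
    U = UX.leading (n ℕ.* m ℕ.+ h₁)

    U-dim : HasDim X U (n ℕ.* m ℕ.+ h₁)
    U-dim = UX.leading-dim (ℕₚ.+-monoʳ-≤ (n ℕ.* m) (ℕₚ.<⇒≤ h₁<m))

    -- By `skew-kernel` the kernel consists of the multiples of any non-zero element `u` of it, so a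
    -- coordinate at which `u` does not vanish detects all of its non-zero elements.
    kernel-coordinate : ∀ b c → ¬ (b ≈ 0# × c ≈ 0#) →
      ∃ λ j → ∀ t → skew b c t ≈ 0# → CK.coordinates t j F.≈ F.0# → t ≈ 0#
    kernel-coordinate b c bc≉0
      with KF.∃? {P = λ u → skew b c u ≈ 0# × ¬ (u ≈ 0#)}
             (λ u≈v (u∈ker , u≉0) → trans (sym (skew-cong u≈v)) u∈ker , u≉0 ∘ trans u≈v)
             (λ u → (skew b c u KF.≟ 0#) ×-dec ¬? (u KF.≟ 0#))
    -- For a trivial kernel any index serves, and `h₁<m` provides one.
    ... | no trivial = fromℕ< h₁<m , λ t t∈ker _ → decidable-stable (t KF.≟ 0#) (λ t≉0 → trivial (t , t∈ker , t≉0))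
    ... | yes (u , u∈ker , u≉0) with Finₚ.any? (λ j → ¬? (CK.coordinates u j FF.≟ F.0#))
    ...   | no none = contradiction (CK.coordinates-injective λ j → F.trans
              (decidable-stable (CK.coordinates u j FF.≟ F.0#) (λ uj≉0 → none (j , uj≉0))) (F.sym (CK.coordinates-0 refl j))) u≉0
    ...   | yes (j , uj≉0) = j , λ t t∈ker tj≈0 →
              let (r , t≈ru) = skew-kernel b c bc≉0 u≉0 t∈ker u∈ker
                  ruj≈0 = F.trans (F.sym (F.trans (CK.coordinates-cong t≈ru j) (CK.coordinates-* r u j))) tj≈0
                  r≈0 = FF.x≉0∧xy≈0⇒y≈0 uj≉0 (F.trans (F.*-comm _ r) ruj≈0)
              in trans t≈ru (trans (*-congʳ (trans (⟦⟧-cong r≈0) ⟦⟧-0)) (zeroˡ u))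

    -- A vector of the intersection is pinned down by `h₁ + 1` scalars: the first `h₁` coordinates
    -- of its last component, the others being 0 in `U`, and one coordinate of its parameter that
    -- separates solutions differing by a kernel element. Counting turns this into the bound.
    dim-U∩line≤h : ∀ {S x y} → NonZero x y → (∀ {z} → z ∈ Subspace.member S → z ∈ Subspace.member (line x y)) →
      ∀ {d} {w : Vector Carrierᴹ d} → IsBasis X (_∩_ X U S) w → d ℕ.≤ suc h₁
    dim-U∩line≤h {S} {x} {y} xy≉0 S⊆l {d} {w} basis
      with j₀ , faithful ← kernel-coordinate y (twist x) (λ (y≈0 , c≈0) → xy≉0 (twist≈0⇒≈0 c≈0 , y≈0)) =
      LX.independent⇒≤ (IsBasis.independent basis)
        (λ r → CK.coordinates (τ r) j₀ ∷ᵛ λ i → CK.coordinates (L (τ r)) (inject≤ i (ℕₚ.<⇒≤ h₁<m)))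
        λ r r′ eq → ≈ᴹ-trans (⊙≈point r) (≈ᴹ-trans (point-cong x y
          (τ-injective r r′ (L≈ r r′ (eq ∘ suc)) (eq zero))) (≈ᴹ-sym (⊙≈point r′)))
      where
      L : K.Carrier → K.Carrier
      L = skew y (twist x)

      in-U∩S : ∀ r → r ⊙ w ∈ Subspace.member (_∩_ X U S)
      in-U∩S = LX.combination-closed (_∩_ X U S) (IsBasis.inside basis)

      τ : Vector F.Carrier d → K.Carrier
      τ r = proj₁ (lower (S⊆l (proj₂ (in-U∩S r))))

      ⊙≈point : ∀ r → r ⊙ w ≈ᴹ point x y (τ r)
      ⊙≈point r = proj₂ (lower (S⊆l (proj₂ (in-U∩S r))))

      L-high : ∀ r j → h₁ ℕ.≤ toℕ j → CK.coordinates (L (τ r)) j F.≈ F.0#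
      L-high r j h₁≤j = F.trans (F.sym (pack-last (λ i → τ r * x i) _ j)) (F.trans (F.sym (CX.coordinates-cong (⊙≈point r) _))
        (lower (proj₁ (in-U∩S r)) _
          (≡.subst (n ℕ.* m ℕ.+ h₁ ℕ.≤_) (≡.sym (Finₚ.toℕ-↑ʳ (n ℕ.* m) j)) (ℕₚ.+-monoʳ-≤ (n ℕ.* m) h₁≤j))))

      L≈ : ∀ r r′ →
           (∀ i → let i′ = inject≤ i (ℕₚ.<⇒≤ h₁<m) in
             CK.coordinates (L (τ r)) i′ F.≈ CK.coordinates (L (τ r′)) i′) →
           L (τ r) ≈ L (τ r′)
      L≈ r r′ eq = CK.coordinates-injective agree
        where
        agree : ∀ j → CK.coordinates (L (τ r)) j F.≈ CK.coordinates (L (τ r′)) j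
        agree j with toℕ j ℕₚ.<? h₁
        ... | no  j≮h₁ = F.trans (L-high r j (ℕₚ.≮⇒≥ j≮h₁)) (F.sym (L-high r′ j (ℕₚ.≮⇒≥ j≮h₁)))
        ... | yes j<h₁ = ≡.subst (λ j → CK.coordinates (L (τ r)) j F.≈ CK.coordinates (L (τ r′)) j)
          (Finₚ.toℕ-injective (≡.trans (Finₚ.toℕ-inject≤ _ _) (Finₚ.toℕ-fromℕ< j<h₁))) (eq (fromℕ< j<h₁))

      τ-injective : ∀ r r′ → L (τ r) ≈ L (τ r′) → CK.coordinates (τ r) j₀ F.≈ CK.coordinates (τ r′) j₀ → τ r ≈ τ r′
      -- `faithful` speaks of the kernel and is applied to the difference of the two parameters,
      -- where `L` and the coordinate `j₀` both vanish by additivity.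
      τ-injective r r′ L≈ eq = x-y≈0⇒x≈y t t′ (faithful (t - t′)
        (trans (sym (x+y-y≈x _ (L t′)))
          (trans (+-congʳ (trans (sym (skew-+ y (twist x) (t - t′) t′)) (trans (skew-cong (x-y+y≈x t t′)) L≈)))
            (K.-‿inverseʳ _)))
        (F.trans (F.sym (RingLemmas.x+y-y≈x R _ (CK.coordinates t′ j₀)))
          (F.trans (F.+-congʳ (F.trans (F.sym (CK.coordinates-+ (t - t′) t′ j₀))
              (F.trans (CK.coordinates-cong (x-y+y≈x t t′) j₀) eq)))
            (F.-‿inverseʳ _))))
        where
        t = τ r
        t′ = τ r′

    -- `HasDim≤` asks for an actual basis of the intersection; membership is decidable and `X` is
    -- finite, so the greedy choice finds one.
    dim-U∩line : ∀ {S x y} → _≋_ X S (line x y) → ∃ λ d → HasDim X (_∩_ X U S) d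
    dim-U∩line {S} {x} {y} (S⊆l , l⊆S) = LX.decidable⇒dim FX.to (λ z → FX.from z , FX.to-from z) FX._≟_ (_∩_ X U S)
      (λ z → UX.leading? _ z ×-dec map′ l⊆S S⊆l (line? x y z))
      where module FX = FiniteSetoid CX.finite

    isEvasive : IsEvasive X 𝒜 (suc h₁) U
    isEvasive {S} (x , y , xy≉0 , S≋l) = bound (dim-U∩line {S} S≋l)
      where
      bound : (∃ λ d → HasDim X (_∩_ X U S) d) → HasDim≤ X (_∩_ X U S) (suc h₁)
      bound (d , w , basis) = d , dim-U∩line≤h {S} xy≉0 (proj₁ S≋l) basis , w , basis

-- Tightness of the apartness yields the inverse of a non-zero element only up to double negation.
-- Finiteness makes invertibility decidable, by search, and so removes it.
fieldRing-isFiniteField : ∀ {c ℓ₁ ℓ₂} (F : HeytingField c ℓ₁ ℓ₂) {q} → HasOrder F q → IsFiniteField (fieldRing F) q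
fieldRing-isFiniteField F {q} order = record
  { finite = finite
  ; 1≉0    = λ 1≈0 → proj₂ (tight 1# 0#) 1≈0
      (invertible⇒# (1# , trans (*-identityˡ _) (x-0≈x 1#) , trans (*-identityʳ _) (x-0≈x 1#)))
  ; invert = λ x x≉0 → decidable-stable (invertible? x) λ not-invertible → x≉0 (proj₁ (tight x 0#) λ x#0 →
      let (y , _ , xy≈1) = #⇒invertible x#0 in not-invertible (y , trans (*-congʳ (sym (x-0≈x x))) xy≈1))
  }
  where
  open HeytingField F
  open RingLemmas (fieldRing F) using (x-0≈x)
  finite = Bijection⇒Inverse order
  module FS = FiniteSetoid {S = CommutativeRing.setoid (fieldRing F)} finite
  invertible? : ∀ x → Dec (∃ λ y → x * y ≈ 1#)
  invertible? x = FS.∃? {P = λ y → x * y ≈ 1#} (λ y≈z eq → trans (*-congˡ (sym y≈z)) eq) (λ y → FS._≟_ (x * y) 1#)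

open import Data.Nat.Base using (_+_; _*_; _∸_; _≤_)

theorem3p5 : ∀ {c ℓ₁ ℓ₂ a ℓ} (q : ℕ) → PrimePower q →
    (F : HeytingField c ℓ₁ ℓ₂) → HasOrder F q →
    (m n h : ℕ) → 1 ≤ m → 2 ≤ n → 1 ≤ h → h ≤ m →
    (X : VectorSpace F a ℓ) → HasDim X (whole X) (m * n) →
    ∃ λ (𝒜 : Collection X) → IsSpread X m 𝒜 ×
    (∃ λ (U : Subspace X) → IsEvasive X 𝒜 h U × HasDim X U (m * (n ∸ 1) + h ∸ 1))
-- From here on `n` and `h` denote the predecessors of the numbers in the statement, so `U` has
-- dimension `n m + h`.
theorem3p5 q primePower F order m (suc n) (suc h) 1≤m (ℕ.s≤s _) (ℕ.s≤s _) h<m X hasDimX =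
  S.𝒜 , S.isSpread , Ev.U , Ev.isEvasive , ≡.subst (HasDim X Ev.U) dim-U Ev.U-dim
  where
  isFiniteField = fieldRing-isFiniteField F order
  dim-X : m ℕ.* suc n ≡ n ℕ.* m ℕ.+ m
  dim-X = ≡.trans (ℕₚ.*-comm m (suc n)) (ℕₚ.+-comm m (n ℕ.* m))
  dim-U : n ℕ.* m ℕ.+ h ≡ m ℕ.* n ℕ.+ suc h ℕ.∸ 1
  dim-U = ≡.trans (≡.cong (ℕ._+ h) (ℕₚ.*-comm n m)) (≡.sym (≡.cong (ℕ._∸ 1) (ℕₚ.+-suc (m ℕ.* n) h)))
  module S = Spread {n = n} primePower isFiniteField (exists-extension primePower isFiniteField m 1≤m) X
    (≡.subst (HasDim X (whole X)) dim-X hasDimX)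
  module Ev = S.Evasive h<m
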